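{- Let $P$ be an $n$-element unit interval order, with elements labeled $1,\dots,n$ so that $\beta(1)\le\cdots\le\beta(n)$, and let $w=w(P)\in\mathfrak S_n$ be the corresponding $312$-avoiding permutation. Then $$\sum_{\lambda\vdash n}\phi_q^\lambda(\mathrm{inc}(P))=\sum_{v\le w}q^{\ell(v)}=\sum_Uq^{\mathrm{inv}(U)},$$ where the middle sum is over $v\in\mathfrak S_n$ below $w$ in the Bruhat order, $\ell(v)$ is the Coxeter length, and $U$ in the final sum varies over all $P$-excedance-free $P$-permutations.
   Context: A unit interval order is a finite poset having no induced subposet isomorphic to a disjoint sum of a 3-element chain and a 1-element chain, and none isomorphic to a disjoint sum of two 2-element chains. For $y\in P$ put $\beta(y)=\#\{x\in P: x\le_Py\}-\#\{z\in P: z\ge_Py\}$. With $P$ labeled by $[n]$ so that $\beta(1)\le\cdots\le\beta(n)$, define $w(P)=w_1\cdots w_n$ recursively by $w_j=\max(\{i: i\not>_Pj\}\setminus\{w_1,\dots,w_{j-1}\})$; this is a $312$-avoiding permutation. The incomparability graph $\mathrm{inc}(P)$ has vertex set $P=[n]$ and an edge $\{i,j\}$ for each incomparable pair. For a proper coloring $\kappa:[n]\to\{1,2,\dots\}$ of $\mathrm{inc}(P)$, let $\mathrm{inv}_{\mathrm{inc}(P)}(\kappa)$ be the number of edges $\{i,j\}$ with $i<j$ and $\kappa(i)>\kappa(j)$. The Shareshian–Wachs chromatic quasisymmetric function is $X_{\mathrm{inc}(P),q}=\sum_\kappa q^{\mathrm{inv}_{\mathrm{inc}(P)}(\kappa)}x_{\kappa(1)}\cdots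 x_{\kappa(n)}$, summed over proper colorings $\kappa$. For $P$ a unit interval order labeled by $[n]$ so that $\beta(1)\le\cdots\le\beta(n)$ it is known to be symmetric, and $\phi_q^\lambda(\mathrm{inc}(P))$ denotes the coefficients in its elementary expansion: $X_{\mathrm{inc}(P),q}=\sum_{\lambda\vdash n}\phi_q^\lambda(\mathrm{inc}(P))\,e_\lambda$. A $P$-permutation is a listing $U=v_1\cdots v_n$ of all elements of $P=[n]$. It is $P$-excedance-free if there is no $i$ with $v_i>_Pi$. $\mathrm{inv}(U)$ is the number of pairs $(i,j)$ with $j>i$ (as integers) and $j$ appearing to the left of $i$ in $U$. -}

module Defs where

open import Data.Fin.Base as Fin using (Fin; zero; suc; inject₁; toℕ)
import Data.Fin.Properties as Fin
open import Data.Fin.Permutation as Perm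
  using (Permutation′; _⟨$⟩ʳ_; _⟨$⟩ˡ_; _∘ₚ_; transpose; insert; lift₀; _≈_)
open import Data.Fin.Permutation.Transposition.List using (TranspositionList; eval; decompose; eval-decompose)
open import Data.Integer.Base as ℤ using (ℤ; +_; 0ℤ; 1ℤ)
open import Data.List.Base as List
  using (List; []; _∷_; [_]; _++_; length; lookup; filter; foldr; map; concatMap; replicate;
         upTo; allFin; cartesianProduct; cartesianProductWith)
open import Data.List.Relation.Unary.All as All using (All)
open import Data.List.Relation.Unary.Linked as Linked using (Linked)
open import Data.Nat.Base as ℕ using (ℕ; zero; suc; pred; _∸_)
import Data.Nat.Properties as ℕ
open import Data.Nat.Induction using (Acc; acc; <-wellFounded)
open import Data.Product.Base using (Σ; ∃; ∃-syntax; _×_; _,_; proj₁; proj₂)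
open import Data.Sum.Relation.Binary.Pointwise using (⊎-poset)
open import Data.Vec.Base as Vec using (Vec; []; _∷_)
open import Function.Base using (_∘_)
open import Level using (0ℓ)
open import Relation.Binary.Bundles using (Poset)
open import Relation.Binary.Core using (Rel)
open import Relation.Binary.Morphism.Structures using (IsOrderMonomorphism)
open import Relation.Binary.PropositionalEquality.Core using (_≡_; _≢_; refl; sym; trans; cong)
open import Relation.Binary.Structures using (IsDecPartialOrder)
open import Relation.Nullary.Decidable using (Dec; yes; no; map′; _×-dec_; _→-dec_; ¬?)
open import Relation.Nullary.Negation using (¬_; contradiction)
open import Relation.Unary using (Pred; Decidable)
import Relation.Binary.Construct.NonStrictToStrict as ToStrict

private
  variable
    A : Set
    n : ℕ

vectors : List A → ∀ k → List (Vec A k)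
vectors xs zero    = [ [] ]
vectors xs (suc k) = cartesianProductWith _∷_ xs (vectors xs k)

# : {P : Pred (Fin n) 0ℓ} → Decidable P → ℕ
# {n} P? = length (filter P? (allFin n))

#pairs : {P : Pred (Fin n × Fin n) 0ℓ} → Decidable P → ℕ
#pairs {n} P? = length (filter P? (cartesianProduct (allFin n) (allFin n)))

-- The ring ℤ[q].  A polynomial is its list of coefficients, constant term
-- first; trailing zeros are allowed, so equality is `_≈ₚ_`.

ℤ[q] : Set
ℤ[q] = List ℤ

coeff : ℤ[q] → ℕ → ℤ
coeff []      _       = 0ℤ
coeff (a ∷ p) zero    = a
coeff (a ∷ p) (suc k) = coeff p k

infix 4 _≈ₚ_
_≈ₚ_ : Rel ℤ[q] 0ℓ
p ≈ₚ r = ∀ k → coeff p k ≡ coeff r k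

infixl 6 _+ₚ_
_+ₚ_ : ℤ[q] → ℤ[q] → ℤ[q]
[]      +ₚ r       = r
(a ∷ p) +ₚ []      = a ∷ p
(a ∷ p) +ₚ (b ∷ r) = (a ℤ.+ b) ∷ (p +ₚ r)

infixr 7 _•_
_•_ : ℤ → ℤ[q] → ℤ[q]
c • p = map (c ℤ.*_) p

q^_ : ℕ → ℤ[q]
q^ k = replicate k 0ℤ ++ [ 1ℤ ]

Σₚ : List A → (A → ℤ[q]) → ℤ[q]
Σₚ xs f = foldr (λ x p → f x +ₚ p) [] xs

-- Power series in x₁, x₂, …  The list a₁ ∷ … ∷ aₘ ∷ [] stands for the monomial
-- x₁^a₁ ⋯ xₘ^aₘ, and a series is the function giving the coefficient of each
-- monomial.

Monomial : Set
Monomial = List ℕ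

Series : Set → Set
Series R = Monomial → R

factorizations : Monomial → List (Monomial × Monomial)
factorizations []      = [ [] , [] ]
factorizations (k ∷ a) =
  cartesianProductWith (λ i (b , c) → i ∷ b , (k ∸ i) ∷ c) (upTo (suc k)) (factorizations a)

one : Series ℤ
one a with All.all? (ℕ._≟ 0) a
... | yes _ = 1ℤ
... | no  _ = 0ℤ

infixl 7 _⊛_
_⊛_ : Series ℤ → Series ℤ → Series ℤ
(f ⊛ g) a = foldr (λ (b , c) s → f b ℤ.* g c ℤ.+ s) 0ℤ (factorizations a)

elementary : ℕ → Series ℤ
elementary k a with All.all? (ℕ._≤? 1) a ×-dec (List.sum a ℕ.≟ k)
... | yes _ = 1ℤ
... | no  _ = 0ℤ

e[_] : List ℕ → Series ℤ
e[ λs ] = foldr (λ k f → elementary k ⊛ f) one λs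

infix 4 _⊢_ _⊢?_
_⊢_ : List ℕ → ℕ → Set
λs ⊢ n = All (0 ℕ.<_) λs × Linked ℕ._≥_ λs × List.sum λs ≡ n

_⊢?_ : ∀ λs n → Dec (λs ⊢ n)
λs ⊢? n = All.all? (0 ℕ.<?_) λs ×-dec Linked.linked? ℕ._≥?_ λs ×-dec (List.sum λs ℕ.≟ n)

-- A partition of n has at most n parts, each of them at most n.
partitions : ℕ → List (List ℕ)
partitions n =
  filter (_⊢? n) (concatMap (λ k → map Vec.toList (vectors (upTo (suc n)) k)) (upTo (suc n)))

-- The symmetric group.  A permutation π has one-line notation π(1) ⋯ π(n), where
-- π(i) is π ⟨$⟩ʳ i.  In `π ∘ₚ ρ` the permutation π is applied first.

-- Each permutation of Fin (suc n) is listed by its first letter and the pattern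
-- of the remaining letters, so every permutation occurs exactly once up to _≈_.
permutations : ∀ n → List (Permutation′ n)
permutations zero    = [ Perm.id ]
permutations (suc n) = cartesianProductWith (insert zero) (allFin (suc n)) (permutations n)

simple : ∀ n → Fin (pred n) → Permutation′ n
simple (suc n) i = transpose (inject₁ i) (suc i)

word : ∀ n {k} → Vec (Fin (pred n)) k → Permutation′ n
word n []      = Perm.id
word n (i ∷ s) = simple n i ∘ₚ word n s

-- Length of a shortest expression as a product of simple transpositions.
record IsCoxeterLength (π : Permutation′ n) (k : ℕ) : Set where
  field
    reduced : ∃[ s ] word n {k} s ≈ π
    minimal : ∀ {j} (s : Vec (Fin (pred n)) j) → word n s ≈ π → k ℕ.≤ j

private
  Generated : Permutation′ n → Set
  Generated {n} π = Σ ℕ λ k → Σ (Vec (Fin (pred n)) k) λ s → word n s ≈ π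

  word-++ : ∀ {j k} (s : Vec (Fin (pred n)) j) (t : Vec (Fin (pred n)) k) →
            word n (s Vec.++ t) ≈ word n s ∘ₚ word n t
  word-++     []      t _ = refl
  word-++ {n} (i ∷ s) t x = word-++ s t (simple n i ⟨$⟩ʳ x)

  gen-≈ : {π ρ : Permutation′ n} → π ≈ ρ → Generated π → Generated ρ
  gen-≈ eq (k , s , p) = k , s , λ x → trans (p x) (eq x)

  gen-id : Generated (Perm.id {n})
  gen-id = 0 , [] , λ _ → refl

  gen-∘ : {π ρ : Permutation′ n} → Generated π → Generated ρ → Generated (π ∘ₚ ρ)
  gen-∘ {n} {ρ = ρ} (_ , s , p) (_ , t , r) =
    _ , s Vec.++ t , λ x → trans (word-++ {n} s t x) (trans (r _) (cong (ρ ⟨$⟩ʳ_) (p x)))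

  gen-simple : (i : Fin (pred n)) → Generated (simple n i)
  gen-simple i = 1 , i ∷ [] , λ _ → refl

  word-lift : ∀ {k} (s : Vec (Fin n) k) →
              word (suc (suc n)) (Vec.map suc s) ≈ lift₀ (word (suc n) s)
  word-lift     []      x = sym (Perm.lift₀-id x)
  word-lift {n} (i ∷ s) x =
    trans (word-lift s _)
      (trans (cong (lift₀ (word (suc n) s) ⟨$⟩ʳ_) (Perm.lift₀-transpose (inject₁ i) (suc i) x))
             (Perm.lift₀-comp (simple (suc n) i) (word (suc n) s) x))

  gen-lift : {π : Permutation′ n} → Generated π → Generated (lift₀ π)
  gen-lift {zero}  {π} _           = 0 , [] , λ { zero → refl }
  gen-lift {suc n} {π} (k , s , p) =
    k , Vec.map suc s , λ x → trans (word-lift s x) (Perm.lift₀-cong (word (suc n) s) π p x)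

  transpose-refl : (i : Fin n) → Perm.id ≈ transpose i i
  transpose-refl i x with x Fin.≟ i
  ... | yes refl = refl
  ... | no  x≢i with x Fin.≟ i
  ...   | yes refl = refl
  ...   | no  _    = refl

  -- (0 1)(1 j+2)(0 1) = (0 j+2)
  conjugate : (j : Fin n) →
    transpose zero (suc zero) ∘ₚ transpose (suc zero) (suc (suc j)) ∘ₚ transpose zero (suc zero)
      ≈ transpose zero (suc (suc j))
  conjugate j zero with j Fin.≟ j
  ... | _ = refl
  conjugate j (suc zero)    = refl
  conjugate j (suc (suc x)) with x Fin.≟ j
  ... | yes _ = refl
  ... | no  _ = refl

  gen-transpose₀ : (j : Fin n) → Generated (transpose zero (suc j))
  gen-transpose₀ zero    = gen-simple zero
  gen-transpose₀ (suc j) =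
    gen-≈ {π = s₀ ∘ₚ t ∘ₚ s₀} {transpose zero (suc (suc j))} (conjugate j)
      (gen-∘ {π = s₀} {t ∘ₚ s₀} (gen-simple zero) (gen-∘ {π = t} {s₀} gen-t (gen-simple zero)))
    where
    s₀ = transpose zero (suc zero)
    t  = transpose (suc zero) (suc (suc j))
    gen-t : Generated t
    gen-t = gen-≈ {π = lift₀ (transpose zero (suc j))} {t}
      (λ x → sym (Perm.lift₀-transpose zero (suc j) x))
      (gen-lift {π = transpose zero (suc j)} (gen-transpose₀ j))

  gen-transpose : (i j : Fin n) → Generated (transpose i j)
  gen-transpose {suc n} zero zero =
    gen-≈ {suc n} {Perm.id} {transpose zero zero} (transpose-refl zero) gen-id
  gen-transpose zero    (suc j) = gen-transpose₀ j
  gen-transpose (suc i) zero    =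
    gen-≈ {π = transpose zero (suc i)} {transpose (suc i) zero} comm (gen-transpose₀ i)
    where
    comm : transpose zero (suc i) ≈ transpose (suc i) zero
    comm zero    = refl
    comm (suc x) with x Fin.≟ i
    ... | yes _ = refl
    ... | no  _ = refl
  gen-transpose (suc i) (suc j) =
    gen-≈ {π = lift₀ (transpose i j)} {transpose (suc i) (suc j)}
      (λ x → sym (Perm.lift₀-transpose i j x)) (gen-lift {π = transpose i j} (gen-transpose i j))

  gen-eval : (ts : TranspositionList n) → Generated (eval ts)
  gen-eval []             = gen-id
  gen-eval ((i , j) ∷ ts) = gen-∘ {π = transpose i j} {eval ts} (gen-transpose i j) (gen-eval ts)

  generated : (π : Permutation′ n) → Generated π
  generated π = gen-≈ {π = eval (decompose π)} {π} (eval-decompose π) (gen-eval (decompose π))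

infix 4 _≈?_
_≈?_ : (π ρ : Permutation′ n) → Dec (π ≈ ρ)
π ≈? ρ = Fin.all? λ i → (π ⟨$⟩ʳ i) Fin.≟ (ρ ⟨$⟩ʳ i)

private
  anyVec? : ∀ {m k} {P : Pred (Vec (Fin m) k) 0ℓ} → Decidable P → Dec (∃ P)
  anyVec? {k = zero}  P? = map′ (λ p → [] , p) (λ { ([] , p) → p }) (P? [])
  anyVec? {k = suc k} P? =
    map′ (λ (x , s , p) → x ∷ s , p) (λ { (x ∷ s , p) → x , s , p })
      (Fin.any? λ x → anyVec? λ s → P? (x ∷ s))

  shortest : (π : Permutation′ n) → ∀ k → Acc ℕ._<_ k → (s : Vec (Fin (pred n)) k) →
             word n s ≈ π → ∃ (IsCoxeterLength π)
  shortest {n} π k (acc rs) s p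
    with ℕ.anyUpTo? (λ j → anyVec? {k = j} (λ t → word n t ≈? π)) k
  ... | yes (j , j<k , t , r) = shortest π j (rs j<k) t r
  ... | no  none = k , record
    { reduced = s , p
    ; minimal = λ t r → ℕ.≮⇒≥ λ j<k → none (_ , j<k , t , r)
    }

coxeterLength : (π : Permutation′ n) → ∃ (IsCoxeterLength π)
coxeterLength π = let (k , s , p) = generated π in shortest π k (<-wellFounded k) s p

ℓ : Permutation′ n → ℕ
ℓ π = proj₁ (coxeterLength π)

infix 4 _≤ᴮ_ _≤ᴮ?_

-- Bruhat order: generated by w·t < w for transpositions t with ℓ(w·t) < ℓ(w).
-- `transpose i j ∘ₚ w` is the product w·t as functions.
data _≤ᴮ_ {n} (v w : Permutation′ n) : Set where
  here  : v ≈ w → v ≤ᴮ w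
  below : ∀ i j → ℓ (transpose i j ∘ₚ w) ℕ.< ℓ w → v ≤ᴮ transpose i j ∘ₚ w → v ≤ᴮ w

_≤ᴮ?_ : (v w : Permutation′ n) → Dec (v ≤ᴮ w)
v ≤ᴮ? w = go w (<-wellFounded (ℓ w))
  where
  go : ∀ w → Acc ℕ._<_ (ℓ w) → Dec (v ≤ᴮ w)
  go w (acc rs) with v ≈? w
  ... | yes v≈w = yes (here v≈w)
  ... | no  v≉w = map′ (λ (i , j , lt , le) → below i j lt le)
                       (λ { (here v≈w) → contradiction v≈w v≉w
                          ; (below i j lt le) → i , j , lt , le })
                       (Fin.any? λ i → Fin.any? λ j → step i j)
    where
    step : ∀ i j → Dec (ℓ (transpose i j ∘ₚ w) ℕ.< ℓ w × v ≤ᴮ transpose i j ∘ₚ w)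
    step i j with ℓ (transpose i j ∘ₚ w) ℕ.<? ℓ w
    ... | no  ≮  = no (≮ ∘ proj₁)
    ... | yes lt = map′ (lt ,_) proj₂ (go (transpose i j ∘ₚ w) (rs lt))

-- The number of pairs i < j such that j stands to the left of i in U.
inv : Permutation′ n → ℕ
inv {n} U = #pairs {n} λ (i , j) → i Fin.<? j ×-dec (U ⟨$⟩ˡ j) Fin.<? (U ⟨$⟩ˡ i)

-- An order embedding of Q is an isomorphism onto an induced subposet of P.
HasInduced : Poset 0ℓ 0ℓ 0ℓ → Poset 0ℓ 0ℓ 0ℓ → Set
HasInduced P Q = ∃ (IsOrderMonomorphism Q._≈_ P._≈_ Q._≤_ P._≤_)
  where
  module P = Poset P
  module Q = Poset Q

chain : ℕ → Poset 0ℓ 0ℓ 0ℓ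
chain = Fin.≤-poset

-- The ground set is {1, …, n} itself, here Fin n; no compatibility between _≼_
-- and the numerical order is imposed except through `WellLabeled` below.
record UnitIntervalOrder (n : ℕ) : Set₁ where
  infix 4 _≼_ _≺_ _≺?_
  field
    _≼_               : Rel (Fin n) 0ℓ
    isDecPartialOrder : IsDecPartialOrder _≡_ _≼_

  open IsDecPartialOrder isDecPartialOrder public
    using (isPartialOrder) renaming (_≤?_ to _≼?_)

  poset : Poset 0ℓ 0ℓ 0ℓ
  poset = record { isPartialOrder = isPartialOrder }

  field
    3+1-free : ¬ HasInduced poset (⊎-poset (chain 3) (chain 1))
    2+2-free : ¬ HasInduced poset (⊎-poset (chain 2) (chain 2))

  _≺_ : Rel (Fin n) 0ℓ
  _≺_ = ToStrict._<_ _≡_ _≼_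

  _≺?_ : ∀ i j → Dec (i ≺ j)
  _≺?_ = ToStrict.<-decidable _≡_ _≼_ Fin._≟_ _≼?_

  β : Fin n → ℤ
  β y = + # (λ x → x ≼? y) ℤ.- + # (λ z → y ≼? z)

  Incomparable : Rel (Fin n) 0ℓ
  Incomparable i j = ¬ i ≼ j × ¬ j ≼ i

  incomparable? : ∀ i j → Dec (Incomparable i j)
  incomparable? i j = ¬? (i ≼? j) ×-dec ¬? (j ≼? i)

module _ (P : UnitIntervalOrder n) where
  open UnitIntervalOrder P

  WellLabeled : Set
  WellLabeled = ∀ i j → i Fin.≤ j → β i ℤ.≤ β j

  IsMaximum : Fin n → Pred (Fin n) 0ℓ → Set
  IsMaximum m S = S m × (∀ i → S i → i Fin.≤ m)

  -- w_j = max ({ i : i is not above j in P } ∖ { w_k : k < j }); this determines w.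
  IsWord : Permutation′ n → Set
  IsWord w = ∀ j → IsMaximum (w ⟨$⟩ʳ j) λ i → ¬ j ≺ i × (∀ k → k Fin.< j → i ≢ w ⟨$⟩ʳ k)

  ExcedanceFree : Permutation′ n → Set
  ExcedanceFree U = ¬ (∃[ i ] i ≺ U ⟨$⟩ʳ i)

  excedanceFree? : Decidable ExcedanceFree
  excedanceFree? U = ¬? (Fin.any? λ i → i ≺? (U ⟨$⟩ʳ i))

  module _ {m : ℕ} (κ : Fin n → Fin m) where

    Proper : Set
    Proper = ∀ i j → Incomparable i j → κ i ≢ κ j

    proper? : Dec Proper
    proper? = Fin.all? λ i → Fin.all? λ j → incomparable? i j →-dec ¬? (κ i Fin.≟ κ j)

    colorInv : ℕ
    colorInv = #pairs {n} λ (i , j) → i Fin.<? j ×-dec incomparable? i j ×-dec κ j Fin.<? κ i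

  -- κ has monomial x_κ(1) ⋯ x_κ(n) equal to a, where the list a of exponents
  -- determines which colours can occur: c : Fin (length a) stands for x_(c+1).
  HasMonomial : (a : Monomial) → (Fin n → Fin (length a)) → Set
  HasMonomial a κ = ∀ c → # (λ i → κ i Fin.≟ c) ≡ lookup a c

  hasMonomial? : ∀ a κ → Dec (HasMonomial a κ)
  hasMonomial? a κ = Fin.all? λ c → # (λ i → κ i Fin.≟ c) ℕ.≟ lookup a c

  chromatic : Series ℤ[q]
  chromatic a = Σₚ (filter (λ κ → proper? (Vec.lookup κ) ×-dec hasMonomial? a (Vec.lookup κ))
                           (vectors (allFin (length a)) n))
                   (λ κ → q^ colorInv (Vec.lookup κ))

  IsElementaryExpansion : (List ℕ → ℤ[q]) → Set
  IsElementaryExpansion φ = ∀ a → chromatic a ≈ₚ Σₚ (partitions n) λ λs → e[ λs ] a • φ λs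

-- Let L(f) = ∑ (-1)^(n - ℓ(α)) [x^α] f over the compositions α of n.  On quasisymmetric
-- functions L(e_k f) = L(f), so L(e_λ) = 1 and L turns X_{inc(P),q} into ∑ φ_q^λ.  By
-- definition L(X) is a signed sum of q^inv over proper colourings onto {1, …, m}.  The point
-- labelled 1 is inserted into such a colouring of the other points either as a new block, or,
-- with opposite sign, into a block containing none of its d neighbours.  Its neighbours form
-- a clique, hence occupy d different blocks, and everything cancels except 1 + q + ⋯ + q^d.
-- Deleting the first letter gives the same recursion for ∑ q^inv(U): that letter takes
-- the values 1, …, d + 1, and the pattern of the rest is excedance-free for P ∖ {1}.
--
-- The labels satisfy i′ ≤ i ≺ j ≤ j′ ⇒ i′ ≺ j′, so lowering a permutation in the Bruhat order
-- creates no excedance.  Conversely an excedance-free v ≠ w is raised to another one by moving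
-- w_j to the first position j where v and w differ; hence v ≤ w iff v is excedance-free.

module Submission where

open import Defs
open import Algebra.Properties.CommutativeSemigroup using (interchange; x∙yz≈y∙xz)
import Algebra.Properties.Semiring.Sum as SemiringSum
open import Data.Bool.Base using (true; false; if_then_else_; _∧_)
open import Data.Empty using (⊥; ⊥-elim)
open import Data.Fin.Base as Fin using (Fin; zero; suc; toℕ; inject₁; punchIn; punchOut; fromℕ<)
open import Data.Fin.Permutation as Perm
  using (Permutation′; _⟨$⟩ʳ_; _⟨$⟩ˡ_; _∘ₚ_; transpose; insert; _≈_)
import Data.Fin.Permutation.Components as Components
open import Data.Fin.Induction using (<-weakInduction; >-weakInduction)
import Data.Fin.Properties as Fin
open import Data.Integer.Base as ℤ using (ℤ; 0ℤ; 1ℤ; _+_; _*_; -_; _-_)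
import Data.Integer.Properties as ℤ
open import Data.Integer.Tactic.RingSolver using (solve-∀)
open import Data.List using (List; filter)
open import Data.List.Base as List
  using ([]; _∷_; _++_; length; foldr; map; applyUpTo; upTo; allFin; cartesianProductWith; cartesianProduct)
import Data.List.Properties as List
open import Data.List.Relation.Unary.All as All using (All; []; _∷_)
import Data.List.Relation.Unary.All.Properties as All
open import Data.Nat using (ℕ)
open import Data.Nat.Base as ℕ using (zero; suc; pred; _∸_; s≤s; z≤n)
import Data.Nat.ListAction as ListAction
import Data.Nat.Properties as ℕ
open import Data.Product using (_×_)
open import Data.Product.Base using (∃; _,_; proj₁; proj₂)
open import Data.Sum.Base using (_⊎_; inj₁; inj₂; [_,_]′)
open import Data.Sum.Relation.Binary.Pointwise as Pointwise using (⊎-poset)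
open import Data.Vec.Base as Vec using (Vec; []; _∷_)
import Data.Vec.Properties as Vec
open import Function.Base using (_∘_; id)
open import Level using (0ℓ)
open import Relation.Binary.Bundles using (Poset)
open import Relation.Binary.Core using (Rel)
open import Relation.Binary.Definitions using (tri<; tri≈; tri>)
open import Relation.Binary.PropositionalEquality
  using (_≡_; _≢_; _≗_; refl; sym; trans; cong; cong₂; subst; module ≡-Reasoning)
open import Relation.Nullary.Decidable
  using (Dec; yes; no; does; ¬?; _×-dec_; _→-dec_; dec-true; dec-false; decidable-stable)
open import Relation.Nullary.Negation using (¬_; contradiction)
open import Relation.Unary using (Pred; Decidable)

-- Identities of polynomials are checked one coefficient of q at a time. So L acts on integer
-- series, and later a polynomial in q is seen only through a functional `g` on its exponents: a
-- factor 1 + q + ⋯ + q^d acts on `g`, and the induction on n is carried out for all `g` at once.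
-- The rule L(e_k f) = L(f) comes from the first variable. Either e_k takes x₁ or it does not; the
-- two choices leave f the same exponent when the parts they start from differ by one, so they carry
-- opposite signs and cancel. What survives is the case where e_k uses up x₁ and leaves f the
-- exponent 0, which quasisymmetry deletes. Monotonicity of β is awkward under deletion of a point,
-- since β counts all points. The induction therefore keeps only the strict relation with the three
-- rules of `Hessenberg`, which restrict verbatim. Since `ℓ` is the length of a shortest word, it is
-- first identified with the number of inversions, and the effect of an arbitrary transposition on
-- that number is reduced to adjacent ones.

module ∑ℕ = SemiringSum ℕ.+-*-semiring
open SemiringSum ℤ.+-*-semiring
  using (sum; sum-cong-≗; ∑-distrib-+; sum-remove; sum-replicate-zero; *-distribˡ-sum)

private
  variable
    A B C : Set
    m n : ℕ

-- Alternating sums of coefficients over compositions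

∑ˡ : List A → (A → ℤ) → ℤ
∑ˡ xs f = foldr (λ x s → f x + s) 0ℤ xs

∑ˡ-cong : ∀ (xs : List A) {f g : A → ℤ} → (∀ x → f x ≡ g x) → ∑ˡ xs f ≡ ∑ˡ xs g
∑ˡ-cong []       eq = refl
∑ˡ-cong (x ∷ xs) eq = cong₂ _+_ (eq x) (∑ˡ-cong xs eq)

∑ˡ-cong-All : ∀ {P : Pred A 0ℓ} {xs : List A} {f g : A → ℤ} →
              All P xs → (∀ {x} → P x → f x ≡ g x) → ∑ˡ xs f ≡ ∑ˡ xs g
∑ˡ-cong-All []         eq = refl
∑ˡ-cong-All (px ∷ pxs) eq = cong₂ _+_ (eq px) (∑ˡ-cong-All pxs eq)

∑ˡ-zero : ∀ (xs : List A) → ∑ˡ xs (λ _ → 0ℤ) ≡ 0ℤ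
∑ˡ-zero []       = refl
∑ˡ-zero (x ∷ xs) = trans (ℤ.+-identityˡ _) (∑ˡ-zero xs)

∑ˡ-++ : ∀ (xs ys : List A) (f : A → ℤ) → ∑ˡ (xs ++ ys) f ≡ ∑ˡ xs f + ∑ˡ ys f
∑ˡ-++ []       ys f = sym (ℤ.+-identityˡ _)
∑ˡ-++ (x ∷ xs) ys f = trans (cong (f x +_) (∑ˡ-++ xs ys f)) (sym (ℤ.+-assoc (f x) _ _))

∑ˡ-map : ∀ (h : A → B) (xs : List A) (f : B → ℤ) → ∑ˡ (map h xs) f ≡ ∑ˡ xs (f ∘ h)
∑ˡ-map h []       f = refl
∑ˡ-map h (x ∷ xs) f = cong (f (h x) +_) (∑ˡ-map h xs f)

∑ˡ-cartesianProductWith : ∀ (h : A → B → C) xs ys (f : C → ℤ) →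
  ∑ˡ (cartesianProductWith h xs ys) f ≡ ∑ˡ xs λ x → ∑ˡ ys λ y → f (h x y)
∑ˡ-cartesianProductWith h []       ys f = refl
∑ˡ-cartesianProductWith h (x ∷ xs) ys f =
  trans (∑ˡ-++ (map (h x) ys) _ f)
        (cong₂ _+_ (∑ˡ-map (h x) ys f) (∑ˡ-cartesianProductWith h xs ys f))

∑ˡ-applyUpTo-zero : ∀ (h : ℕ → A) n {f : A → ℤ} → (∀ i → f (h i) ≡ 0ℤ) → ∑ˡ (applyUpTo h n) f ≡ 0ℤ
∑ˡ-applyUpTo-zero h zero    eq = refl
∑ˡ-applyUpTo-zero h (suc n) {f} eq = cong₂ _+_ (eq 0) (∑ˡ-applyUpTo-zero (h ∘ suc) n {f} (eq ∘ suc))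

-- Not a derivative, but the coefficient of x₁^a as a series in the remaining variables.
∂ : ℕ → Series ℤ → Series ℤ
∂ a f α = f (a ∷ α)

-- altSum f n = ∑ (-1)^(n - ℓ(α)) f(α) over the compositions α of n.  In altSum₊ the
-- first part is split off: altSum₊ g n = ∑_{a < n} (-1)^a altSum (g a) (n - 1 - a).
mutual
  altSum : Series ℤ → ℕ → ℤ
  altSum f zero    = f []
  altSum f (suc n) = altSum₊ (λ a → ∂ (suc a) f) (suc n)

  altSum₊ : (ℕ → Series ℤ) → ℕ → ℤ
  altSum₊ g zero    = 0ℤ
  altSum₊ g (suc n) = altSum (g 0) n - altSum₊ (g ∘ suc) n

mutual
  -- Only compositions are ever evaluated. Both restrictions on `α` matter later: positivity
  -- discards colourings that miss a colour, and the bound on the length makes the number of colours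
  -- at most `n`.
  altSum-cong : ∀ {f g} n → (∀ α → All (0 ℕ.<_) α → length α ℕ.≤ n → f α ≡ g α) → altSum f n ≡ altSum g n
  altSum-cong zero    eq = eq [] [] z≤n
  altSum-cong (suc n) eq = altSum₊-cong (suc n) (λ a α pos l → eq (suc a ∷ α) (s≤s z≤n ∷ pos) l)

  altSum₊-cong : ∀ {f g} n → (∀ a α → All (0 ℕ.<_) α → length α ℕ.< n → f a α ≡ g a α) →
                 altSum₊ f n ≡ altSum₊ g n
  altSum₊-cong zero    eq = refl
  altSum₊-cong (suc n) eq =
    cong₂ _-_ (altSum-cong n (λ α pos l → eq 0 α pos (s≤s l)))
              (altSum₊-cong n (λ a α pos l → eq (suc a) α pos (ℕ.m≤n⇒m≤1+n l)))

sub-interchange : ∀ a b c d → (a + b) - (c + d) ≡ (a - c) + (b - d)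
sub-interchange = solve-∀

mutual
  altSum-+ : ∀ f g n → altSum (λ α → f α + g α) n ≡ altSum f n + altSum g n
  altSum-+ f g zero    = refl
  altSum-+ f g (suc n) = altSum₊-+ (λ a → ∂ (suc a) f) (λ a → ∂ (suc a) g) (suc n)

  altSum₊-+ : ∀ f g n → altSum₊ (λ a α → f a α + g a α) n ≡ altSum₊ f n + altSum₊ g n
  altSum₊-+ f g zero    = refl
  altSum₊-+ f g (suc n) =
    trans (cong₂ _-_ (altSum-+ (f 0) (g 0) n) (altSum₊-+ (f ∘ suc) (g ∘ suc) n))
          (sub-interchange (altSum (f 0) n) _ _ _)

mutual
  altSum-zero : ∀ n → altSum (λ _ → 0ℤ) n ≡ 0ℤ
  altSum-zero zero    = refl
  altSum-zero (suc n) = altSum₊-zero (suc n)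

  altSum₊-zero : ∀ n → altSum₊ (λ _ _ → 0ℤ) n ≡ 0ℤ
  altSum₊-zero zero    = refl
  altSum₊-zero (suc n) = cong₂ _-_ (altSum-zero n) (altSum₊-zero n)

mutual
  altSum-* : ∀ f c n → altSum (λ α → f α * c) n ≡ altSum f n * c
  altSum-* f c zero    = refl
  altSum-* f c (suc n) = altSum₊-* (λ a → ∂ (suc a) f) c (suc n)

  altSum₊-* : ∀ g c n → altSum₊ (λ a α → g a α * c) n ≡ altSum₊ g n * c
  altSum₊-* g c zero    = refl
  altSum₊-* g c (suc n) =
    trans (cong₂ _-_ (altSum-* (g 0) c n) (altSum₊-* (g ∘ suc) c n))
          (distrib (altSum (g 0) n) _ c)
    where
    distrib : ∀ a b c → a * c - b * c ≡ (a - b) * c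
    distrib = solve-∀

altSum-∑ˡ : ∀ (xs : List A) (f : A → Series ℤ) n →
            altSum (λ α → ∑ˡ xs λ x → f x α) n ≡ ∑ˡ xs λ x → altSum (f x) n
altSum-∑ˡ []       f n = altSum-zero n
altSum-∑ˡ (x ∷ xs) f n = trans (altSum-+ (f x) _ n) (cong (altSum (f x) n +_) (altSum-∑ˡ xs f n))

altSum-sum : ∀ (f : Fin m → Series ℤ) n →
             altSum (λ α → sum λ i → f i α) n ≡ sum λ i → altSum (f i) n
altSum-sum {m = zero}  f n = altSum-zero n
altSum-sum {m = suc m} f n =
  trans (altSum-+ (f zero) _ n) (cong (altSum (f zero) n +_) (altSum-sum (f ∘ suc) n))

-- The product e_k · f, computed one variable at a time.
e·_ : ℕ → Series ℤ → Series ℤ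
(e· zero)  f []          = f []
(e· suc k) f []          = 0ℤ
(e· k)     f (zero ∷ α)  = (e· k) (∂ 0 f) α
(e· zero)  f (suc a ∷ α) = (e· zero) (∂ (suc a) f) α
(e· suc k) f (suc a ∷ α) = (e· suc k) (∂ (suc a) f) α + (e· k) (∂ a f) α

e·-cong : ∀ k {f g} α → (∀ β → f β ≡ g β) → (e· k) f α ≡ (e· k) g α
e·-cong zero    []          eq = eq []
e·-cong (suc k) []          eq = refl
e·-cong zero    (zero ∷ α)  eq = e·-cong zero α (eq ∘ (0 ∷_))
e·-cong (suc k) (zero ∷ α)  eq = e·-cong (suc k) α (eq ∘ (0 ∷_))
e·-cong zero    (suc a ∷ α) eq = e·-cong zero α (eq ∘ (suc a ∷_))
e·-cong (suc k) (suc a ∷ α) eq =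
  cong₂ _+_ (e·-cong (suc k) α (eq ∘ (suc a ∷_))) (e·-cong k α (eq ∘ (a ∷_)))

e·-zero : ∀ f α → (e· zero) f α ≡ f α
e·-zero f []          = refl
e·-zero f (zero ∷ α)  = e·-zero (∂ 0 f) α
e·-zero f (suc a ∷ α) = e·-zero (∂ (suc a) f) α

elementary-true : ∀ {k α} → All (ℕ._≤ 1) α → ListAction.sum α ≡ k → elementary k α ≡ 1ℤ
elementary-true {k} {α} ≤1 s with All.all? (ℕ._≤? 1) α ×-dec (ListAction.sum α ℕ.≟ k)
... | yes _ = refl
... | no ¬p = contradiction (≤1 , s) ¬p

elementary-false : ∀ {k α} → ¬ (All (ℕ._≤ 1) α × ListAction.sum α ≡ k) → elementary k α ≡ 0ℤ
elementary-false {k} {α} ¬p with All.all? (ℕ._≤? 1) α ×-dec (ListAction.sum α ℕ.≟ k)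
... | yes p = contradiction p ¬p
... | no _  = refl

elementary-≡ : ∀ {k j α β} →
               (All (ℕ._≤ 1) α × ListAction.sum α ≡ k → All (ℕ._≤ 1) β × ListAction.sum β ≡ j) →
               (All (ℕ._≤ 1) β × ListAction.sum β ≡ j → All (ℕ._≤ 1) α × ListAction.sum α ≡ k) →
               elementary k α ≡ elementary j β
elementary-≡ {k} {j} {α} {β} to from
  with All.all? (ℕ._≤? 1) α ×-dec (ListAction.sum α ℕ.≟ k)
... | yes p = let (≤1 , s) = to p in sym (elementary-true {j} {β} ≤1 s)
... | no ¬p = sym (elementary-false {j} {β} (¬p ∘ from))

elementary-0∷ : ∀ k α → elementary k (0 ∷ α) ≡ elementary k α
elementary-0∷ k α = elementary-≡ {k} {k} {0 ∷ α} {α} (λ { (_ ∷ p , s) → p , s }) (λ (p , s) → z≤n ∷ p , s)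

elementary-1∷ : ∀ k α → elementary (suc k) (1 ∷ α) ≡ elementary k α
elementary-1∷ k α =
  elementary-≡ {suc k} {k} {1 ∷ α} {α} (λ { (_ ∷ p , s) → p , ℕ.suc-injective s }) (λ (p , s) → s≤s z≤n ∷ p , cong suc s)

elementary-2+∷ : ∀ k a α → elementary k (suc (suc a) ∷ α) ≡ 0ℤ
elementary-2+∷ k a α = elementary-false {k} {suc (suc a) ∷ α} λ { (s≤s () ∷ _ , _) }

-- Each variable occurs in e_k with exponent at most 1, so of all splittings of the first exponent
-- only i = 0 and i = 1 survive; they are the two summands in the recursion for `e·_`.
elementary-⊛ : ∀ k f α → (elementary k ⊛ f) α ≡ (e· k) f α
elementary-⊛ zero    f []      = trans (ℤ.+-identityʳ _) (ℤ.*-identityˡ (f []))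
elementary-⊛ (suc k) f []      = refl
elementary-⊛ k       f (a ∷ α) = 
  trans (∑ˡ-cartesianProductWith (λ i (β , γ) → i ∷ β , (a ∸ i) ∷ γ) (upTo (suc a)) (factorizations α)
           (λ (β , γ) → elementary k β * f γ))
        (split k a)
  where
  term : ℕ → ℕ → ℕ → ℤ
  term k a i = ∑ˡ (factorizations α) λ (β , γ) → elementary k (i ∷ β) * f ((a ∸ i) ∷ γ)

  zeroth : ∀ k a → term k a 0 ≡ (e· k) (∂ a f) α
  zeroth k a = trans (∑ˡ-cong (factorizations α) λ (β , γ) → cong (_* f (a ∷ γ)) (elementary-0∷ k β))
                     (elementary-⊛ k (∂ a f) α)

  first : ∀ k a → term (suc k) (suc a) 1 ≡ (e· k) (∂ a f) α
  first k a = trans (∑ˡ-cong (factorizations α) λ (β , γ) → cong (_* f (a ∷ γ)) (elementary-1∷ k β))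
                    (elementary-⊛ k (∂ a f) α)

  first₀ : ∀ a → term zero (suc a) 1 ≡ 0ℤ
  first₀ a = trans (∑ˡ-cong (factorizations α) λ (β , γ) →
                      cong (_* f (a ∷ γ)) (elementary-false {0} {1 ∷ β} λ ()))
                   (∑ˡ-zero (factorizations α))

  rest : ∀ k a → ∑ˡ (applyUpTo (λ i → suc (suc i)) a) (term k (suc a)) ≡ 0ℤ
  rest k a = ∑ˡ-applyUpTo-zero (λ i → suc (suc i)) a {term k (suc a)} λ i →
    trans (∑ˡ-cong (factorizations α) λ (β , γ) → cong (_* f ((suc a ∸ suc (suc i)) ∷ γ)) (elementary-2+∷ k i β))
          (∑ˡ-zero (factorizations α))

  split : ∀ k a → ∑ˡ (upTo (suc a)) (term k a) ≡ (e· k) f (a ∷ α)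
  split zero    zero    = trans (ℤ.+-identityʳ _) (zeroth zero 0)
  split (suc k) zero    = trans (ℤ.+-identityʳ _) (zeroth (suc k) 0)
  split zero    (suc a) =
    trans (cong₂ _+_ (zeroth 0 (suc a)) (cong₂ _+_ (first₀ a) (rest 0 a))) (ℤ.+-identityʳ _)
  split (suc k) (suc a) =
    cong₂ _+_ (zeroth (suc k) (suc a))
              (trans (cong₂ _+_ (first k a) (rest (suc k) a)) (ℤ.+-identityʳ _))

-- Monomials are exponent lists of any length, so this single rule says that a coefficient depends
-- only on the composition formed by the nonzero exponents.
record Quasisymmetric (f : Series ℤ) : Set where
  field
    skip-zero : ∀ α β → f (α ++ 0 ∷ β) ≡ f (α ++ β)

open Quasisymmetric

∂-quasisymmetric : ∀ a {f} → Quasisymmetric f → Quasisymmetric (∂ a f)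
∂-quasisymmetric a qf .skip-zero α β = qf .skip-zero (a ∷ α) β

e·-quasisymmetric : ∀ k {f} → Quasisymmetric f → Quasisymmetric ((e· k) f)
e·-quasisymmetric zero    {f} qf .skip-zero α β =
  trans (e·-zero f (α ++ 0 ∷ β)) (trans (qf .skip-zero α β) (sym (e·-zero f (α ++ β))))
e·-quasisymmetric (suc k) qf .skip-zero []          β = e·-cong (suc k) β (qf .skip-zero [])
e·-quasisymmetric (suc k) qf .skip-zero (zero ∷ α)  β =
  e·-quasisymmetric (suc k) (∂-quasisymmetric 0 qf) .skip-zero α β
e·-quasisymmetric (suc k) qf .skip-zero (suc a ∷ α) β =
  cong₂ _+_ (e·-quasisymmetric (suc k) (∂-quasisymmetric (suc a) qf) .skip-zero α β)
            (e·-quasisymmetric k (∂-quasisymmetric a qf) .skip-zero α β)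

-- The value of `h` at n - k, with default 0 for n < k. It is needed because multiplication by e_k
-- raises the degree by k.
shift : ℕ → (ℕ → ℤ) → ℕ → ℤ
shift zero    h n       = h n
shift (suc k) h zero    = 0ℤ
shift (suc k) h (suc n) = shift k h n

shift-+ : ∀ k h n → shift k h (k ℕ.+ n) ≡ h n
shift-+ zero    h n = refl
shift-+ (suc k) h n = shift-+ k h n

shift-altSum₊-zero : ∀ k g → shift k (altSum₊ g) zero ≡ 0ℤ
shift-altSum₊-zero zero    g = refl
shift-altSum₊-zero (suc k) g = refl

shift-altSum₊-suc : ∀ k g n → shift k (altSum₊ g) (suc n) ≡
                              shift k (altSum (g 0)) n - shift k (altSum₊ (g ∘ suc)) n
shift-altSum₊-suc zero    g n       = refl
shift-altSum₊-suc (suc k) g zero    = shift-altSum₊-zero k g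
shift-altSum₊-suc (suc k) g (suc n) = shift-altSum₊-suc k g n

mutual
  altSum-e· : ∀ k {f} n → Quasisymmetric f → altSum ((e· k) f) n ≡ shift k (altSum f) n
  altSum-e· zero    {f} n       qf = altSum-cong n (λ α _ _ → e·-zero f α)
  altSum-e· (suc k)     zero    qf = refl
  altSum-e· (suc k) {f} (suc n) qf = begin
    altSum₊ (λ a α → (e· suc k) (∂ (suc a) f) α + (e· k) (∂ a f) α) (suc n)
      ≡⟨ altSum₊-+ (λ a → (e· suc k) (∂ (suc a) f)) (λ a → (e· k) (∂ a f)) (suc n) ⟩
    altSum₊ (λ a → (e· suc k) (∂ (suc a) f)) (suc n) + altSum₊ (λ a → (e· k) (∂ a f)) (suc n)
      ≡⟨ cong₂ _+_ (altSum₊-e· (suc k) (suc n) λ a → ∂-quasisymmetric (suc a) qf)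
                   (trans (altSum₊-e· k (suc n) λ a → ∂-quasisymmetric a qf) (shift-altSum₊-suc k _ n)) ⟩
    -- `y` gathers the terms in which f keeps a positive exponent of x₁. It appears with sign + when
    -- e_k does not take x₁ and, since the part is then larger by one, with sign - when it does.
    y + (shift k (altSum (∂ 0 f)) n - y)
      ≡⟨ cancel y _ ⟩
    shift k (altSum (∂ 0 f)) n
      ≡⟨ shift-cong k n (λ i → altSum-cong i (λ α _ _ → qf .skip-zero [] α)) ⟩
    shift k (altSum f) n ∎
    where
    open ≡-Reasoning
    y = shift k (altSum₊ (λ a → ∂ (suc a) f)) n
    cancel : ∀ y z → y + (z - y) ≡ z
    cancel = solve-∀
    shift-cong : ∀ k {h h′} n → (∀ i → h i ≡ h′ i) → shift k h n ≡ shift k h′ n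
    shift-cong zero    n       eq = eq n
    shift-cong (suc k) zero    eq = refl
    shift-cong (suc k) (suc n) eq = shift-cong k n eq

  altSum₊-e· : ∀ k {g} n → (∀ a → Quasisymmetric (g a)) →
               altSum₊ (λ a → (e· k) (g a)) n ≡ shift k (altSum₊ g) n
  altSum₊-e· k {g} zero    qg = sym (shift-altSum₊-zero k g)
  altSum₊-e· k {g} (suc n) qg =
    trans (cong₂ _-_ (altSum-e· k n (qg 0)) (altSum₊-e· k n (qg ∘ suc)))
          (sym (shift-altSum₊-suc k g n))

one-quasisymmetric : Quasisymmetric one
one-quasisymmetric .skip-zero α β with All.all? (ℕ._≟ 0) (α ++ 0 ∷ β) | All.all? (ℕ._≟ 0) (α ++ β)
... | yes _ | yes _ = refl
... | no _  | no _  = refl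
... | yes p | no ¬q = contradiction (All.++⁺ (All.++⁻ˡ α p) (All.tail (All.++⁻ʳ α p))) ¬q
... | no ¬p | yes q = contradiction (All.++⁺ (All.++⁻ˡ α q) (refl ∷ All.++⁻ʳ α q)) ¬p

e-quasisymmetric : ∀ μ → Quasisymmetric e[ μ ]
e-quasisymmetric []      = one-quasisymmetric
e-quasisymmetric (k ∷ μ) .skip-zero α β =
  trans (elementary-⊛ k e[ μ ] (α ++ 0 ∷ β))
    (trans (e·-quasisymmetric k (e-quasisymmetric μ) .skip-zero α β) (sym (elementary-⊛ k e[ μ ] (α ++ β))))

-- Every factor e_k is stripped off by `altSum-e·` while the degree drops by k; what is left is
-- `one` in degree 0, evaluated at the empty composition.
altSum-e : ∀ μ → altSum e[ μ ] (ListAction.sum μ) ≡ 1ℤ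
altSum-e []      = refl
altSum-e (k ∷ μ) = begin
  altSum (elementary k ⊛ e[ μ ]) (k ℕ.+ ListAction.sum μ)
    ≡⟨ altSum-cong (k ℕ.+ ListAction.sum μ) (λ α _ _ → elementary-⊛ k e[ μ ] α) ⟩
  altSum ((e· k) e[ μ ]) (k ℕ.+ ListAction.sum μ)
    ≡⟨ altSum-e· k (k ℕ.+ ListAction.sum μ) (e-quasisymmetric μ) ⟩
  shift k (altSum e[ μ ]) (k ℕ.+ ListAction.sum μ)
    ≡⟨ shift-+ k _ (ListAction.sum μ) ⟩
  altSum e[ μ ] (ListAction.sum μ)
    ≡⟨ altSum-e μ ⟩
  1ℤ ∎
  where open ≡-Reasoning

-- Coefficients in q and the elementary expansion

coeff-+ₚ : ∀ p r k → coeff (p +ₚ r) k ≡ coeff p k + coeff r k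
coeff-+ₚ []      r       k       = sym (ℤ.+-identityˡ _)
coeff-+ₚ (a ∷ p) []      k       = sym (ℤ.+-identityʳ _)
coeff-+ₚ (a ∷ p) (b ∷ r) zero    = refl
coeff-+ₚ (a ∷ p) (b ∷ r) (suc k) = coeff-+ₚ p r k

coeff-• : ∀ c p k → coeff (c • p) k ≡ c * coeff p k
coeff-• c []      k       = sym (ℤ.*-zeroʳ c)
coeff-• c (a ∷ p) zero    = refl
coeff-• c (a ∷ p) (suc k) = coeff-• c p k

coeff-Σₚ : ∀ (xs : List A) f k → coeff (Σₚ xs f) k ≡ ∑ˡ xs λ x → coeff (f x) k
coeff-Σₚ []       f k = refl
coeff-Σₚ (x ∷ xs) f k = trans (coeff-+ₚ (f x) (Σₚ xs f) k) (cong (coeff (f x) k +_) (coeff-Σₚ xs f k))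

altSum-chromatic : ∀ (P : UnitIntervalOrder n) φ → IsElementaryExpansion P φ → ∀ k →
                   altSum (λ α → coeff (chromatic P α) k) n ≡ coeff (Σₚ (partitions n) φ) k
altSum-chromatic {n} P φ X≈ k = begin
  altSum (λ α → coeff (chromatic P α) k) n
    ≡⟨ altSum-cong n (λ α _ _ → trans (X≈ α k)
         (trans (coeff-Σₚ (partitions n) _ k)
                (∑ˡ-cong (partitions n) λ μ → coeff-• (e[ μ ] α) (φ μ) k))) ⟩
  altSum (λ α → ∑ˡ (partitions n) λ μ → e[ μ ] α * coeff (φ μ) k) n
    ≡⟨ altSum-∑ˡ (partitions n) _ n ⟩
  ∑ˡ (partitions n) (λ μ → altSum (λ α → e[ μ ] α * coeff (φ μ) k) n)
    -- `altSum-e` evaluates L only in the degree of `μ`, so `μ ⊢ n` has to be recovered from the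
    -- filter that lists the partitions.
    ≡⟨ ∑ˡ-cong-All (All.all-filter (_⊢? n) candidates) (λ {μ} → coefficient μ) ⟩
  ∑ˡ (partitions n) (λ μ → coeff (φ μ) k)
    ≡⟨ coeff-Σₚ (partitions n) φ k ⟨
  coeff (Σₚ (partitions n) φ) k ∎
  where
  open ≡-Reasoning
  candidates = List.concatMap (λ k → map Vec.toList (vectors (upTo (suc n)) k)) (upTo (suc n))
  coefficient : ∀ μ → μ ⊢ n → altSum (λ α → e[ μ ] α * coeff (φ μ) k) n ≡ coeff (φ μ) k
  coefficient μ (_ , _ , refl) =
    trans (altSum-* e[ μ ] _ n) (trans (cong (_* coeff (φ μ) k) (altSum-e μ)) (ℤ.*-identityˡ _))

-- Inversions and Coxeter length

⟦_⟧ : Dec A → ℕ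
⟦ d ⟧ = if does d then 1 else 0

count : {P : Pred (Fin n) 0ℓ} → Decidable P → ℕ
count P? = ∑ℕ.sum λ i → ⟦ P? i ⟧

length-filter-tabulate : ∀ {P : Pred A 0ℓ} (P? : Decidable P) (f : Fin n → A) →
                         length (filter P? (List.tabulate f)) ≡ ∑ℕ.sum λ i → ⟦ P? (f i) ⟧
length-filter-tabulate {n = zero}  P? f = refl
length-filter-tabulate {n = suc n} P? f with does (P? (f zero))
... | true  = cong suc (length-filter-tabulate P? (f ∘ suc))
... | false = length-filter-tabulate P? (f ∘ suc)

#≡count : {P : Pred (Fin n) 0ℓ} (P? : Decidable P) → # P? ≡ count P?
#≡count P? = length-filter-tabulate P? id

length-filter-cartesianProduct : ∀ {P : Pred (A × Fin n) 0ℓ} (P? : Decidable P) (f : Fin m → A) →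
  length (filter P? (cartesianProduct (List.tabulate f) (allFin n))) ≡ ∑ℕ.sum λ i → count λ j → P? (f i , j)
length-filter-cartesianProduct {m = zero} P? f = refl
length-filter-cartesianProduct {n = n} {m = suc m} P? f = begin
  length (filter P? (row ++ rest))
    ≡⟨ cong length (List.filter-++ P? row rest) ⟩
  length (filter P? row ++ filter P? rest)
    ≡⟨ List.length-++ (filter P? row) ⟩
  length (filter P? row) ℕ.+ length (filter P? rest)
    ≡⟨ cong₂ ℕ._+_ (trans (cong (length ∘ filter P?) (List.map-tabulate id (f zero ,_)))
                          (length-filter-tabulate P? (f zero ,_)))
                   (length-filter-cartesianProduct P? (f ∘ suc)) ⟩
  count (λ j → P? (f zero , j)) ℕ.+ ∑ℕ.sum (λ i → count λ j → P? (f (suc i) , j)) ∎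
  where
  open ≡-Reasoning
  row  = map (f zero ,_) (allFin n)
  rest = cartesianProduct (List.tabulate (f ∘ suc)) (allFin n)

#pairs≡∑count : {P : Pred (Fin n × Fin n) 0ℓ} (P? : Decidable P) →
                #pairs P? ≡ ∑ℕ.sum λ i → count λ j → P? (i , j)
#pairs≡∑count P? = length-filter-cartesianProduct P? id

-- Counted by positions, with the first one split off, to suit induction on the first letter;
-- letters in ℕ spare a relabelling when one of them is removed.
inversions : (Fin n → ℕ) → ℕ
inversions {zero}  f = 0
inversions {suc n} f = count (λ j → f (suc j) ℕ.<? f zero) ℕ.+ inversions (f ∘ suc)

inversions-cong : ∀ {f g : Fin n → ℕ} → f ≗ g → inversions f ≡ inversions g
inversions-cong {zero}  eq = refl
inversions-cong {suc n} eq =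
  cong₂ ℕ._+_ (∑ℕ.sum-cong-≗ λ j → cong₂ (λ x y → ⟦ x ℕ.<? y ⟧) (eq (suc j)) (eq zero))
              (inversions-cong (eq ∘ suc))

∑∑≡inversions : ∀ (f : Fin n → ℕ) →
  ∑ℕ.sum (λ i → count λ j → i Fin.<? j ×-dec f j ℕ.<? f i) ≡ inversions f
∑∑≡inversions {zero}  f = refl
∑∑≡inversions {suc n} f = cong (count (λ j → f (suc j) ℕ.<? f zero) ℕ.+_) (∑∑≡inversions (f ∘ suc))

⟦⟧-∧-comm : ∀ (a : Dec A) (b : Dec B) → ⟦ a ×-dec b ⟧ ≡ ⟦ b ×-dec a ⟧
⟦⟧-∧-comm a b with does a | does b
... | true  | true  = refl
... | true  | false = refl
... | false | true  = refl
... | false | false = refl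

-- An inversion is a pair of positions or, equivalently, the pair of values standing there.
-- Reindexing both sums along the inverse of `U` passes from one to the other; the larger value
-- comes first, whence the exchange of the two sums.
inv≡inversions : ∀ (U : Permutation′ n) → inv U ≡ inversions (toℕ ∘ (U ⟨$⟩ʳ_))
inv≡inversions {n} U = sym (begin
  inversions (toℕ ∘ (U ⟨$⟩ʳ_))
    ≡⟨ ∑∑≡inversions (toℕ ∘ (U ⟨$⟩ʳ_)) ⟨
  ∑ℕ.sum (λ p → ∑ℕ.sum λ q → cell p q)
    ≡⟨ ∑ℕ.sum-permute (λ p → ∑ℕ.sum (cell p)) (Perm.flip U) ⟩
  ∑ℕ.sum (λ j → ∑ℕ.sum λ q → cell (U ⟨$⟩ˡ j) q)
    ≡⟨ ∑ℕ.sum-cong-≗ (λ j → ∑ℕ.sum-permute (cell (U ⟨$⟩ˡ j)) (Perm.flip U)) ⟩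
  ∑ℕ.sum (λ j → ∑ℕ.sum λ i → cell (U ⟨$⟩ˡ j) (U ⟨$⟩ˡ i))
    ≡⟨ ∑ℕ.∑-comm (λ j i → cell (U ⟨$⟩ˡ j) (U ⟨$⟩ˡ i)) ⟩
  ∑ℕ.sum (λ i → ∑ℕ.sum λ j → cell (U ⟨$⟩ˡ j) (U ⟨$⟩ˡ i))
    ≡⟨ ∑ℕ.sum-cong-≗ (λ i → ∑ℕ.sum-cong-≗ λ j → trans
         (cong₂ (λ x y → ⟦ U ⟨$⟩ˡ j Fin.<? U ⟨$⟩ˡ i ×-dec x Fin.<? y ⟧) (Perm.inverseʳ U) (Perm.inverseʳ U))
         (⟦⟧-∧-comm (U ⟨$⟩ˡ j Fin.<? U ⟨$⟩ˡ i) (i Fin.<? j))) ⟩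
  ∑ℕ.sum (λ i → count λ j → i Fin.<? j ×-dec U ⟨$⟩ˡ j Fin.<? U ⟨$⟩ˡ i)
    ≡⟨ #pairs≡∑count {n} (λ (i , j) → i Fin.<? j ×-dec U ⟨$⟩ˡ j Fin.<? U ⟨$⟩ˡ i) ⟨
  inv U ∎)
  where
  open ≡-Reasoning
  cell : Fin n → Fin n → ℕ
  cell p q = ⟦ p Fin.<? q ×-dec U ⟨$⟩ʳ q Fin.<? U ⟨$⟩ʳ p ⟧

-- Transpositions and the number of inversions

transposeᶜ : Fin n → Fin n → Fin n → Fin n
transposeᶜ = Components.transpose

transpose-suc : ∀ (i j k : Fin n) → transposeᶜ (suc i) (suc j) (suc k) ≡ suc (transposeᶜ i j k)
transpose-suc i j k = Perm.lift₀-transpose i j (suc k)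

-- Each case carries the value of the transposition, so that later proofs need not unfold its nested
-- decisions.
data TransposeView (i j k : Fin n) : Set where
  first  : k ≡ i → transposeᶜ i j k ≡ j → TransposeView i j k
  second : k ≡ j → transposeᶜ i j k ≡ i → TransposeView i j k
  other  : k ≢ i → k ≢ j → transposeᶜ i j k ≡ k → TransposeView i j k

transposeView : ∀ (i j k : Fin n) → TransposeView i j k
transposeView i j k with k Fin.≟ i in p
... | yes k≡i = first k≡i (lemma p)
  where
  lemma : (k Fin.≟ i) ≡ yes k≡i → transposeᶜ i j k ≡ j
  lemma eq rewrite eq = refl
... | no k≢i with k Fin.≟ j in q
...   | yes k≡j = second k≡j (lemma p q)
  where
  lemma : (k Fin.≟ i) ≡ no k≢i → (k Fin.≟ j) ≡ yes k≡j → transposeᶜ i j k ≡ i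
  lemma eq eq′ rewrite eq | eq′ = refl
...   | no k≢j = other k≢i k≢j (lemma p q)
  where
  lemma : (k Fin.≟ i) ≡ no k≢i → (k Fin.≟ j) ≡ no k≢j → transposeᶜ i j k ≡ k
  lemma eq eq′ rewrite eq | eq′ = refl

transpose-first : ∀ (i j : Fin n) → transposeᶜ i j i ≡ j
transpose-first i j with transposeView i j i
... | first _ eq      = eq
... | second i≡j eq   = trans eq i≡j
... | other i≢i _ _   = contradiction refl i≢i

transpose-second : ∀ (i j : Fin n) → transposeᶜ i j j ≡ i
transpose-second i j with transposeView i j j
... | first j≡i eq    = trans eq j≡i
... | second _ eq     = eq
... | other _ j≢j _   = contradiction refl j≢j

transpose-other : ∀ {i j k : Fin n} → k ≢ i → k ≢ j → transposeᶜ i j k ≡ k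
transpose-other {i = i} {j} {k} k≢i k≢j with transposeView i j k
... | first k≡i _     = contradiction k≡i k≢i
... | second k≡j _    = contradiction k≡j k≢j
... | other _ _ eq    = eq

transpose-comm : ∀ (i j : Fin n) → transposeᶜ i j ≗ transposeᶜ j i
transpose-comm i j k with transposeView i j k
... | first refl eq      = trans eq (sym (transpose-second j i))
... | second refl eq     = trans eq (sym (transpose-first j i))
... | other k≢i k≢j eq   = trans eq (sym (transpose-other k≢j k≢i))

transpose-involutive : ∀ (i j k : Fin n) → transposeᶜ i j (transposeᶜ i j k) ≡ k
transpose-involutive i j k =
  trans (cong (transposeᶜ i j) (transpose-comm i j k)) (Components.transpose-inverse i j)

transpose-conjugate : ∀ (j : Fin n) →
  transposeᶜ zero (suc (suc j)) ≗
  transposeᶜ zero (suc zero) ∘ transposeᶜ (suc zero) (suc (suc j)) ∘ transposeᶜ zero (suc zero)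
transpose-conjugate j zero with j Fin.≟ j
... | _ = refl
transpose-conjugate j (suc zero)    = refl
transpose-conjugate j (suc (suc k)) with does (k Fin.≟ j)
... | true  = refl
... | false = refl

count-transpose : ∀ (f : Fin n → ℕ) i j x →
                  count (λ k → f (transposeᶜ i j k) ℕ.<? x) ≡ count (λ k → f k ℕ.<? x)
count-transpose f i j x = sym (∑ℕ.sum-permute (λ k → ⟦ f k ℕ.<? x ⟧) (transpose i j))

⟦⟧-true : ∀ {d : Dec A} → A → ⟦ d ⟧ ≡ 1
⟦⟧-true {d = d} a = cong (if_then 1 else 0) (dec-true d a)

⟦⟧-false : ∀ {d : Dec A} → ¬ A → ⟦ d ⟧ ≡ 0
⟦⟧-false {d = d} ¬a = cong (if_then 1 else 0) (dec-false d ¬a)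

-- Only the pair of the two exchanged letters changes its status. Counts taken against earlier
-- letters are merely permuted, and the counts of the two letters against later ones trade places.
inversions-swap : ∀ (f : Fin (suc n) → ℕ) i → f (inject₁ i) ℕ.< f (suc i) →
                  inversions (f ∘ transposeᶜ (inject₁ i) (suc i)) ≡ suc (inversions f)
inversions-swap {suc n} f zero lt = begin
  ⟦ f zero ℕ.<? f (suc zero) ⟧ ℕ.+ b ℕ.+ (a ℕ.+ r)
    ≡⟨ cong (λ x → x ℕ.+ b ℕ.+ (a ℕ.+ r)) (⟦⟧-true {d = f zero ℕ.<? f (suc zero)} lt) ⟩
  suc (b ℕ.+ (a ℕ.+ r))
    ≡⟨ cong suc (x∙yz≈y∙xz ℕ.+-commutativeSemigroup b a r) ⟩
  suc (a ℕ.+ (b ℕ.+ r))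
    ≡⟨ cong (λ x → suc (x ℕ.+ a ℕ.+ (b ℕ.+ r))) (⟦⟧-false {d = f (suc zero) ℕ.<? f zero} (ℕ.<-asym lt)) ⟨
  suc (inversions f) ∎
  where
  open ≡-Reasoning
  a = count λ k → f (suc (suc k)) ℕ.<? f zero
  b = count λ k → f (suc (suc k)) ℕ.<? f (suc zero)
  r = inversions λ k → f (suc (suc k))
inversions-swap {suc n} f (suc i) lt = begin
  count (λ k → f (transposeᶜ (suc (inject₁ i)) (suc (suc i)) (suc k)) ℕ.<? f zero) ℕ.+
  inversions (λ k → f (transposeᶜ (suc (inject₁ i)) (suc (suc i)) (suc k)))
    ≡⟨ cong₂ ℕ._+_ (∑ℕ.sum-cong-≗ λ k → cong (λ x → ⟦ f x ℕ.<? f zero ⟧) (transpose-suc (inject₁ i) (suc i) k))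
                   (inversions-cong λ k → cong f (transpose-suc (inject₁ i) (suc i) k)) ⟩
  count (λ k → f (suc (transposeᶜ (inject₁ i) (suc i) k)) ℕ.<? f zero) ℕ.+
  inversions (f ∘ suc ∘ transposeᶜ (inject₁ i) (suc i))
    ≡⟨ cong₂ ℕ._+_ (count-transpose (f ∘ suc) (inject₁ i) (suc i) (f zero)) (inversions-swap (f ∘ suc) i lt) ⟩
  count (λ k → f (suc k) ℕ.<? f zero) ℕ.+ suc (inversions (f ∘ suc))
    ≡⟨ ℕ.+-suc _ _ ⟩
  suc (inversions f) ∎
  where open ≡-Reasoning

inversions-unswap : ∀ (f : Fin (suc n) → ℕ) i → f (suc i) ℕ.< f (inject₁ i) →
                    inversions f ≡ suc (inversions (f ∘ transposeᶜ (inject₁ i) (suc i)))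
inversions-unswap f i lt = begin
  inversions f
    ≡⟨ inversions-cong (λ k → cong f (transpose-involutive (inject₁ i) (suc i) k)) ⟨
  inversions (f ∘ transposeᶜ (inject₁ i) (suc i) ∘ transposeᶜ (inject₁ i) (suc i))
    ≡⟨ inversions-swap (f ∘ transposeᶜ (inject₁ i) (suc i)) i
         (ℕ.≤-trans (s≤s (ℕ.≤-reflexive (cong f (transpose-first (inject₁ i) (suc i)))))
           (ℕ.≤-trans lt (ℕ.≤-reflexive (cong f (sym (transpose-second (inject₁ i) (suc i))))))) ⟩
  suc (inversions (f ∘ transposeᶜ (inject₁ i) (suc i))) ∎
  where open ≡-Reasoning

Injective : (Fin n → A) → Set
Injective f = ∀ {i j} → f i ≡ f j → i ≡ j

inversions-transpose-suc : ∀ (f : Fin (suc n) → ℕ) i j →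
  inversions (f ∘ suc) ℕ.< inversions (f ∘ suc ∘ transposeᶜ i j) →
  inversions f ℕ.< inversions (f ∘ transposeᶜ (suc i) (suc j))
inversions-transpose-suc f i j lt = begin
  suc (count (λ k → f (suc k) ℕ.<? f zero) ℕ.+ inversions (f ∘ suc))
    ≡⟨ ℕ.+-suc _ _ ⟨
  count (λ k → f (suc k) ℕ.<? f zero) ℕ.+ suc (inversions (f ∘ suc))
    ≤⟨ ℕ.+-monoʳ-≤ _ lt ⟩
  count (λ k → f (suc k) ℕ.<? f zero) ℕ.+ inversions (f ∘ suc ∘ transposeᶜ i j)
    ≡⟨ cong (ℕ._+ inversions (f ∘ suc ∘ transposeᶜ i j)) (count-transpose (f ∘ suc) i j (f zero)) ⟨
  count (λ k → f (suc (transposeᶜ i j k)) ℕ.<? f zero) ℕ.+ inversions (f ∘ suc ∘ transposeᶜ i j)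
    ≡⟨ cong₂ ℕ._+_ (∑ℕ.sum-cong-≗ λ k → cong (λ x → ⟦ f x ℕ.<? f zero ⟧) (transpose-suc i j k))
                   (inversions-cong λ k → cong f (transpose-suc i j k)) ⟨
  inversions (f ∘ transposeᶜ (suc i) (suc j)) ∎
  where open ℕ.≤-Reasoning

-- (0 j+2) = (0 1)(1 j+2)(0 1), and the two adjacent swaps cannot both destroy an inversion.
inversions-transpose-zero : ∀ (f : Fin (suc (suc (suc n))) → ℕ) → Injective f → ∀ j →
  (let s = transposeᶜ zero (suc zero); t = transposeᶜ (suc zero) (suc (suc j)) in
   inversions (f ∘ s) ℕ.< inversions (f ∘ s ∘ t)) →
  f zero ℕ.< f (suc (suc j)) → inversions f ℕ.< inversions (f ∘ transposeᶜ zero (suc (suc j)))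
inversions-transpose-zero {n} f inj j middle lt =
  subst (inversions f ℕ.<_) (inversions-cong λ k → cong f (sym (transpose-conjugate j k))) conclusion
  where
  s t : Fin (suc (suc (suc n))) → Fin (suc (suc (suc n)))
  s = transposeᶜ zero (suc zero)
  t = transposeᶜ (suc zero) (suc (suc j))

  t₁ : f (suc (suc j)) ≡ f (s (t (suc zero)))
  t₁ = cong (f ∘ s) (sym (transpose-first (suc zero) (suc (suc j))))

  conclusion : inversions f ℕ.< inversions (f ∘ s ∘ t ∘ s)
  open ℕ.≤-Reasoning

  conclusion with ℕ.<-cmp (f zero) (f (suc zero)) | ℕ.<-cmp (f (suc zero)) (f (suc (suc j)))
  ... | tri≈ _ eq _ | _           = contradiction (inj eq) λ ()
  ... | _           | tri≈ _ eq _ = contradiction (inj eq) λ ()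
  ... | tri> _ _ gt | tri> _ _ gt′ = contradiction (ℕ.<-trans gt′ gt) (ℕ.<-asym lt)
  ... | tri< lt₁ _ _ | tri< lt₂ _ _ = begin-strict
    inversions f                 <⟨ ℕ.n<1+n _ ⟩
    suc (inversions f)           ≡⟨ inversions-swap f zero lt₁ ⟨
    inversions (f ∘ s)           <⟨ middle ⟩
    inversions (f ∘ s ∘ t)       ≤⟨ ℕ.n≤1+n _ ⟩
    suc (inversions (f ∘ s ∘ t)) ≡⟨ inversions-swap (f ∘ s ∘ t) zero (subst (f (suc zero) ℕ.<_) t₁ lt₂) ⟨
    inversions (f ∘ s ∘ t ∘ s)   ∎
  ... | tri< lt₁ _ _ | tri> _ _ gt = ℕ.s≤s⁻¹ (begin-strict
    suc (inversions f)           ≡⟨ inversions-swap f zero lt₁ ⟨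
    inversions (f ∘ s)           <⟨ middle ⟩
    inversions (f ∘ s ∘ t)       ≡⟨ inversions-unswap (f ∘ s ∘ t) zero (subst (ℕ._< f (suc zero)) t₁ gt) ⟩
    suc (inversions (f ∘ s ∘ t ∘ s)) ∎)
  ... | tri> _ _ gt | tri< lt₂ _ _ = begin-strict
    inversions f                 ≡⟨ inversions-unswap f zero gt ⟩
    suc (inversions (f ∘ s))     ≤⟨ middle ⟩
    inversions (f ∘ s ∘ t)       <⟨ ℕ.n<1+n _ ⟩
    suc (inversions (f ∘ s ∘ t)) ≡⟨ inversions-swap (f ∘ s ∘ t) zero (subst (f (suc zero) ℕ.<_) t₁ lt₂) ⟨
    inversions (f ∘ s ∘ t ∘ s)   ∎

-- Induction on n. If position 0 is not moved, it is dropped; if it is, (0 j+2) is conjugated by (0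
-- 1) into (1 j+2), which fixes position 0. After this conjugation position 1 holds f(0), so the
-- hypothesis on the two letters is unchanged.
inversions-transpose : ∀ (f : Fin n → ℕ) → Injective f → ∀ i j → i Fin.< j → f i ℕ.< f j →
                       inversions f ℕ.< inversions (f ∘ transposeᶜ i j)
inversions-transpose f inj zero (suc zero) _ lt = ℕ.≤-reflexive (sym (inversions-swap f zero lt))
inversions-transpose {suc (suc n)} f inj (suc i) (suc j) (s≤s i<j) lt =
  inversions-transpose-suc f i j (inversions-transpose (f ∘ suc) (Fin.suc-injective ∘ inj) i j i<j lt)
inversions-transpose {suc (suc (suc n))} f inj zero (suc (suc j)) _ lt =
  inversions-transpose-zero f inj j
    (inversions-transpose-suc (f ∘ s) zero (suc j)
      (inversions-transpose (f ∘ s ∘ suc) inj-s zero (suc j) (s≤s z≤n) lt)) lt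
  where
  s : Fin (suc (suc (suc n))) → Fin (suc (suc (suc n)))
  s = transposeᶜ zero (suc zero)
  inj-s : Injective (f ∘ s ∘ suc)
  inj-s {k} {l} eq = Fin.suc-injective
    (trans (sym (transpose-involutive zero (suc zero) (suc k)))
      (trans (cong s (inj eq)) (transpose-involutive zero (suc zero) (suc l))))

-- Coxeter length is the number of inversions

toℕ-Injective : ∀ (π : Permutation′ n) → Injective (toℕ ∘ (π ⟨$⟩ʳ_))
toℕ-Injective π {i} {j} eq =
  trans (sym (Perm.inverseˡ π)) (trans (cong (π ⟨$⟩ˡ_) (Fin.toℕ-injective eq)) (Perm.inverseˡ π))

-- Prepending a simple transposition exchanges two adjacent letters and so changes the number of
-- inversions by exactly one. This is the lower bound for `ℓ`.
inversions-word : ∀ {k} (s : Vec (Fin (pred n)) k) → inversions (toℕ ∘ (word n s ⟨$⟩ʳ_)) ℕ.≤ k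
inversions-word {n} [] = ℕ.≤-reflexive (inversions-toℕ n id (λ _ _ → id))
  where
  inversions-toℕ : ∀ n (f : ℕ → ℕ) → (∀ x y → x ℕ.≤ y → f x ℕ.≤ f y) → inversions {n} (f ∘ toℕ) ≡ 0
  inversions-toℕ zero    f mono = refl
  inversions-toℕ (suc n) f mono =
    cong₂ ℕ._+_ (trans (∑ℕ.sum-cong-≗ {n} λ j → ⟦⟧-false {d = f (suc (toℕ j)) ℕ.<? f 0} (ℕ.≤⇒≯ (mono _ _ z≤n)))
                       (∑ℕ.sum-replicate-zero n))
                (inversions-toℕ n (f ∘ suc) (λ x y x≤y → mono _ _ (s≤s x≤y)))
inversions-word {suc n} (i ∷ s)
  with ℕ.<-cmp (toℕ (word (suc n) s ⟨$⟩ʳ inject₁ i)) (toℕ (word (suc n) s ⟨$⟩ʳ suc i))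
... | tri< lt _ _ = ℕ.≤-trans
  (ℕ.≤-reflexive (inversions-swap (toℕ ∘ (word (suc n) s ⟨$⟩ʳ_)) i lt)) (s≤s (inversions-word {suc n} s))
... | tri> _ _ gt = ℕ.≤-trans (ℕ.≤-trans (ℕ.n≤1+n _) (ℕ.≤-reflexive (sym (inversions-unswap (toℕ ∘ (word (suc n) s ⟨$⟩ʳ_)) i gt))))
                              (ℕ.m≤n⇒m≤1+n (inversions-word {suc n} s))
... | tri≈ _ eq _ =
  contradiction (trans (sym (Fin.toℕ-inject₁ i)) (cong toℕ (toℕ-Injective (word (suc n) s) eq))) (ℕ.<⇒≢ (ℕ.n<1+n _))

ascending⇒id : ∀ (π : Permutation′ (suc n)) →
               (∀ i → π ⟨$⟩ʳ inject₁ i Fin.< π ⟨$⟩ʳ suc i) → Perm.id ≈ π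
ascending⇒id {n} π asc i = Fin.≤-antisym (lower i) (upper i)
  where
  lower : ∀ i → i Fin.≤ π ⟨$⟩ʳ i
  lower = <-weakInduction (λ i → i Fin.≤ π ⟨$⟩ʳ i) z≤n
    λ i le → ℕ.≤-<-trans (subst (ℕ._≤ toℕ (π ⟨$⟩ʳ inject₁ i)) (Fin.toℕ-inject₁ i) le) (asc i)
  upper : ∀ i → π ⟨$⟩ʳ i Fin.≤ i
  upper = >-weakInduction (λ i → π ⟨$⟩ʳ i Fin.≤ i) (Fin.≤fromℕ _)
    λ i le → subst (toℕ (π ⟨$⟩ʳ inject₁ i) ℕ.≤_) (sym (Fin.toℕ-inject₁ i)) (ℕ.s≤s⁻¹ (ℕ.≤-trans (asc i) le))

-- Sorting by adjacent swaps: undoing a descent removes exactly one inversion, and a permutation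
-- without descents is the identity. This is the upper bound for `ℓ`.
reducedWord : ∀ k (π : Permutation′ n) → inversions (toℕ ∘ (π ⟨$⟩ʳ_)) ≡ k →
              ∃ λ (s : Vec (Fin (pred n)) k) → word n s ≈ π
reducedWord {zero}  zero π eq = [] , λ ()
reducedWord {suc n} k    π eq with Fin.any? (λ i → π ⟨$⟩ʳ suc i Fin.<? π ⟨$⟩ʳ inject₁ i)
reducedWord {suc n} zero π eq | yes (i , gt) = contradiction (trans (sym (inversions-unswap (toℕ ∘ (π ⟨$⟩ʳ_)) i gt)) eq) λ ()
reducedWord {suc n} (suc k) π eq | yes (i , gt) =
  let (s , s≈) = reducedWord k (simple (suc n) i ∘ₚ π)
                   (ℕ.suc-injective (trans (sym (inversions-unswap (toℕ ∘ (π ⟨$⟩ʳ_)) i gt)) eq))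
  in i ∷ s , λ x → trans (s≈ (simple (suc n) i ⟨$⟩ʳ x))
                         (cong (π ⟨$⟩ʳ_) (transpose-involutive (inject₁ i) (suc i) x))
reducedWord {suc n} k π eq | no ¬desc = subst (λ k → ∃ λ (s : Vec (Fin n) k) → word (suc n) s ≈ π) 0≡k ([] , π≈id)
  where
  π≈id : Perm.id ≈ π
  π≈id = ascending⇒id π λ i → ℕ.≤∧≢⇒< (ℕ.≮⇒≥ λ gt → ¬desc (i , gt)) λ eq →
    contradiction (trans (sym (Fin.toℕ-inject₁ i)) (cong toℕ (toℕ-Injective π eq))) (ℕ.<⇒≢ (ℕ.n<1+n _))
  0≡k : 0 ≡ k
  0≡k = trans (sym (ℕ.n≤0⇒n≡0 (inversions-word {suc n} []))) (trans (inversions-cong (cong toℕ ∘ π≈id)) eq)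

ℓ≡inversions : ∀ (π : Permutation′ n) → ℓ π ≡ inversions (toℕ ∘ (π ⟨$⟩ʳ_))
ℓ≡inversions {n} π with coxeterLength π
... | k , isLength = ℕ.≤-antisym
  (let (s , s≈π) = reducedWord _ π refl in minimal s s≈π)
  (let (s , s≈π) = reduced in
   ℕ.≤-trans (ℕ.≤-reflexive (inversions-cong (cong toℕ ∘ sym ∘ s≈π))) (inversions-word {n} s))
  where open IsCoxeterLength isLength

ℓ≡inv : ∀ (π : Permutation′ n) → ℓ π ≡ inv π
ℓ≡inv π = trans (ℓ≡inversions π) (sym (inv≡inversions π))

ℓ-transpose : ∀ (π : Permutation′ n) i j → i Fin.< j → π ⟨$⟩ʳ i Fin.< π ⟨$⟩ʳ j → ℓ π ℕ.< ℓ (transpose i j ∘ₚ π)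
ℓ-transpose π i j i<j lt =
  subst (ℕ._< ℓ (transpose i j ∘ₚ π)) (sym (ℓ≡inversions π))
    (subst (inversions (toℕ ∘ (π ⟨$⟩ʳ_)) ℕ.<_) (sym (ℓ≡inversions (transpose i j ∘ₚ π)))
      (inversions-transpose (toℕ ∘ (π ⟨$⟩ʳ_)) (toℕ-Injective π) i j i<j lt))

ℓ-cong : ∀ {π ρ : Permutation′ n} → π ≈ ρ → ℓ π ≡ ℓ ρ
ℓ-cong {π = π} {ρ} π≈ρ =
  trans (ℓ≡inversions π) (trans (inversions-cong (cong toℕ ∘ π≈ρ)) (sym (ℓ≡inversions ρ)))

-- The Bruhat interval below w

-- The strict order of a unit interval order whose labels increase with β: the boxes (i , j)
-- with i ≺ j are those above a Dyck path.
record Hessenberg (n : ℕ) : Set₁ where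
  infix 4 _≺_ _≺?_
  field
    _≺_     : Rel (Fin n) 0ℓ
    _≺?_    : ∀ i j → Dec (i ≺ j)
    ≺⇒<     : ∀ {i j} → i ≺ j → i Fin.< j
    ≺-monoˡ : ∀ {i′ i j} → i′ Fin.≤ i → i ≺ j → i′ ≺ j
    ≺-monoʳ : ∀ {i j j′} → i ≺ j → j Fin.≤ j′ → i ≺ j′

  NonExcedant : Permutation′ n → Set
  NonExcedant U = ¬ ∃ λ i → i ≺ U ⟨$⟩ʳ i

  nonExcedant? : Decidable NonExcedant
  nonExcedant? U = ¬? (Fin.any? λ i → i ≺? (U ⟨$⟩ʳ i))

-- A derivation of `_≤ᴮ_` descends from its upper end and `below` adds a step there, whereas raising
-- `v` to `u` calls for a step at the lower end.
≤ᴮ-extend : ∀ {u v w : Permutation′ n} i j → u ≤ᴮ w → ℓ (transpose i j ∘ₚ u) ℕ.< ℓ u →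
            v ≈ transpose i j ∘ₚ u → v ≤ᴮ w
≤ᴮ-extend {u = u} {v} {w} i j (here u≈w) lt v≈ =
  below i j
    (ℕ.≤-<-trans (ℕ.≤-reflexive (ℓ-cong {π = transpose i j ∘ₚ w} {transpose i j ∘ₚ u} (λ k → sym (u≈w (transposeᶜ i j k)))))
      (ℕ.<-≤-trans lt (ℕ.≤-reflexive (ℓ-cong {π = u} {w} u≈w))))
    (here λ k → trans (v≈ k) (u≈w (transposeᶜ i j k)))
≤ᴮ-extend i j (below i′ j′ lt′ u≤) lt v≈ = below i′ j′ lt′ (≤ᴮ-extend i j u≤ lt v≈)

module _ (H : Hessenberg n) where
  open Hessenberg H

  -- Position i receives a smaller letter, and the letter w(i) moves to a larger position. By the
  -- two monotonicity rules an excedance at either place would already be one of `w` at i.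
  transpose-nonExcedant : ∀ (w : Permutation′ n) i j → i Fin.< j → w ⟨$⟩ʳ j Fin.< w ⟨$⟩ʳ i →
                          NonExcedant w → NonExcedant (transpose i j ∘ₚ w)
  transpose-nonExcedant w i j i<j lt free (k , k≺) with transposeView i j k
  ... | first refl eq  = free (k , ≺-monoʳ (subst (λ x → k ≺ w ⟨$⟩ʳ x) eq k≺) (ℕ.<⇒≤ lt))
  ... | second refl eq = free (i , ≺-monoˡ (ℕ.<⇒≤ i<j) (subst (λ x → k ≺ w ⟨$⟩ʳ x) eq k≺))
  ... | other _ _ eq   = free (k , subst (λ x → k ≺ w ⟨$⟩ʳ x) eq k≺)

  -- A transposition that shortens `w` must undo an inversion: on a pair in increasing order
  -- `ℓ-transpose` makes it longer.
  down-nonExcedant : ∀ (w : Permutation′ n) i j → ℓ (transpose i j ∘ₚ w) ℕ.< ℓ w →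
                     NonExcedant w → NonExcedant (transpose i j ∘ₚ w)
  down-nonExcedant w i j lt free with Fin.<-cmp i j
  ... | tri< i<j _ _ = transpose-nonExcedant w i j i<j
    (ℕ.≤∧≢⇒< (ℕ.≮⇒≥ λ up → ℕ.<-asym lt (ℓ-transpose w i j i<j up))
             (λ eq → ℕ.<⇒≢ i<j (cong toℕ (sym (toℕ-Injective w eq))))) free
  ... | tri≈ _ refl _ = contradiction (ℓ-cong {π = transpose i i ∘ₚ w} {w} (λ k → cong (w ⟨$⟩ʳ_) (same k))) (ℕ.<⇒≢ lt)
    where
    same : ∀ k → transposeᶜ i i k ≡ k
    same k with transposeView i i k
    ... | first k≡i eq  = trans eq (sym k≡i)
    ... | second k≡i eq = trans eq (sym k≡i)
    ... | other _ _ eq  = eq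
  ... | tri> _ _ j<i = λ (k , k≺) → transpose-nonExcedant w j i j<i
    (ℕ.≤∧≢⇒< (ℕ.≮⇒≥ λ up → ℕ.<-asym lt (ℕ.<-≤-trans (ℓ-transpose w j i j<i up)
                 (ℕ.≤-reflexive (ℓ-cong {π = transpose j i ∘ₚ w} {transpose i j ∘ₚ w}
                                   (λ k → cong (w ⟨$⟩ʳ_) (transpose-comm j i k))))))
             (λ eq → ℕ.<⇒≢ j<i (cong toℕ (sym (toℕ-Injective w eq))))) free
    (k , subst (λ x → k ≺ w ⟨$⟩ʳ x) (transpose-comm i j k) k≺)

  ≤ᴮ⇒nonExcedant : ∀ {v w : Permutation′ n} → v ≤ᴮ w → NonExcedant w → NonExcedant v
  ≤ᴮ⇒nonExcedant (here v≈w) free (i , i≺) = free (i , subst (i ≺_) (v≈w i) i≺)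
  ≤ᴮ⇒nonExcedant {w = w} (below i j lt v≤) free =
    ≤ᴮ⇒nonExcedant v≤ (down-nonExcedant w i j lt free)

  module _ (w : Permutation′ n) (free-w : NonExcedant w)
    (w-max : ∀ j i → ¬ j ≺ i → (∀ k → k Fin.< j → i ≢ w ⟨$⟩ʳ k) → i Fin.≤ w ⟨$⟩ʳ j) where

    -- At the first position j where v differs from w we have v(j) < w(j), and moving
    -- w(j) to position j goes up in the Bruhat order without creating an excedance.
    agreeing⇒≤ᴮ : ∀ d j → d ℕ.+ j ≡ n → (v : Permutation′ n) → NonExcedant v →
                  (∀ k → toℕ k ℕ.< j → v ⟨$⟩ʳ k ≡ w ⟨$⟩ʳ k) → v ≤ᴮ w
    agreeing⇒≤ᴮ zero    j refl v free agree = here λ k → agree k (Fin.toℕ<n k)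
    agreeing⇒≤ᴮ (suc d) j eq   v free agree = step (v ⟨$⟩ʳ J Fin.≟ w ⟨$⟩ʳ J)
      where
      j<n : j ℕ.< n
      j<n = subst (j ℕ.<_) eq (s≤s (ℕ.m≤n+m j d))

      J : Fin n
      J = fromℕ< j<n

      toℕ-J : toℕ J ≡ j
      toℕ-J = Fin.toℕ-fromℕ< j<n

      extend : ∀ (u : Permutation′ n) → (∀ k → toℕ k ℕ.< j → u ⟨$⟩ʳ k ≡ w ⟨$⟩ʳ k) →
               u ⟨$⟩ʳ J ≡ w ⟨$⟩ʳ J → ∀ k → toℕ k ℕ.< suc j → u ⟨$⟩ʳ k ≡ w ⟨$⟩ʳ k
      extend u agree-u at-J k (s≤s k≤j) with ℕ.m≤n⇒m<n∨m≡n k≤j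
      ... | inj₁ k<j = agree-u k k<j
      ... | inj₂ k≡j with refl ← Fin.toℕ-injective {i = k} {J} (trans k≡j (sym toℕ-J)) = at-J

      step : Dec (v ⟨$⟩ʳ J ≡ w ⟨$⟩ʳ J) → v ≤ᴮ w
      step (yes same) = agreeing⇒≤ᴮ d (suc j) (trans (ℕ.+-suc d j) eq) v free (extend v agree same)
      step (no differ) = ≤ᴮ-extend J p u≤w lt-ℓ v≈
        where
        -- The place of the letter w(J) in v. It lies to the right of J, because to the left v
        -- agrees with w, whose letters are distinct.
        p : Fin n
        p = v ⟨$⟩ˡ (w ⟨$⟩ʳ J)

        vp≡wJ : v ⟨$⟩ʳ p ≡ w ⟨$⟩ʳ J
        vp≡wJ = Perm.inverseʳ v

        <j : ∀ {k} → k Fin.< J → toℕ k ℕ.< j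
        <j {k} = subst (toℕ k ℕ.<_) toℕ-J

        J<p : J Fin.< p
        J<p with Fin.<-cmp J p
        ... | tri< lt _ _   = lt
        ... | tri≈ _ J≡p _  = contradiction (trans (cong (v ⟨$⟩ʳ_) J≡p) vp≡wJ) differ
        ... | tri> _ J≢p p<J = contradiction
          (sym (toℕ-Injective w (cong toℕ (trans (sym (agree p (<j p<J))) vp≡wJ)))) J≢p

        -- v(J) was itself a candidate for the letter w(J): it is not above J, and it differs from
        -- the earlier letters, which v shares with w. Maximality of w(J) gives the inequality.
        vJ<vp : v ⟨$⟩ʳ J Fin.< v ⟨$⟩ʳ p
        vJ<vp = subst (v ⟨$⟩ʳ J Fin.<_) (sym vp≡wJ) (ℕ.≤∧≢⇒<
          (w-max J (v ⟨$⟩ʳ J) (λ J≺ → free (J , J≺)) λ k k<J e →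
            ℕ.<⇒≢ k<J (cong toℕ (sym (toℕ-Injective v (cong toℕ (trans e (sym (agree k (<j k<J)))))))))
          (differ ∘ Fin.toℕ-injective))

        u : Permutation′ n
        u = transpose J p ∘ₚ v

        free-u : NonExcedant u
        free-u (k , k≺) with transposeView J p k
        ... | first refl e  = free-w (J , subst (J ≺_) (trans (cong (v ⟨$⟩ʳ_) e) vp≡wJ) k≺)
        ... | second refl e = free (p , ≺-monoʳ (subst (λ x → p ≺ v ⟨$⟩ʳ x) e k≺) (ℕ.<⇒≤ vJ<vp))
        ... | other _ _ e   = free (k , subst (λ x → k ≺ v ⟨$⟩ʳ x) e k≺)

        agree-u : ∀ k → toℕ k ℕ.< j → u ⟨$⟩ʳ k ≡ w ⟨$⟩ʳ k
        agree-u k k<j = trans (cong (v ⟨$⟩ʳ_) (transpose-other (λ k≡J → ℕ.<⇒≢ k<J (cong toℕ k≡J))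
                                                              (λ k≡p → ℕ.<⇒≢ (ℕ.<-trans k<J J<p) (cong toℕ k≡p))))
                              (agree k k<j)
          where
          k<J : k Fin.< J
          k<J = subst (toℕ k ℕ.<_) (sym toℕ-J) k<j

        u≤w : u ≤ᴮ w
        u≤w = agreeing⇒≤ᴮ d (suc j) (trans (ℕ.+-suc d j) eq) u free-u
                (extend u agree-u (trans (cong (v ⟨$⟩ʳ_) (transpose-first J p)) vp≡wJ))

        v≈ : v ≈ transpose J p ∘ₚ u
        v≈ k = cong (v ⟨$⟩ʳ_) (sym (transpose-involutive J p k))

        lt-ℓ : ℓ (transpose J p ∘ₚ u) ℕ.< ℓ u
        lt-ℓ = ℕ.≤-<-trans (ℕ.≤-reflexive (ℓ-cong {π = transpose J p ∘ₚ u} {v} (sym ∘ v≈)))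
                           (ℓ-transpose v J p J<p vJ<vp)

    nonExcedant⇒≤ᴮ : ∀ (v : Permutation′ n) → NonExcedant v → v ≤ᴮ w
    nonExcedant⇒≤ᴮ v free = agreeing⇒≤ᴮ n 0 (ℕ.+-identityʳ n) v free λ _ ()

-- Unit interval orders with increasing β

⟦⟧-mono : ∀ (a : Dec A) (b : Dec B) → (A → B) → ⟦ a ⟧ ℕ.≤ ⟦ b ⟧
⟦⟧-mono (yes a) b f = ℕ.≤-reflexive (sym (⟦⟧-true {d = b} (f a)))
⟦⟧-mono (no _)  b f = z≤n

count-mono-≤ : ∀ {P Q : Pred (Fin n) 0ℓ} (P? : Decidable P) (Q? : Decidable Q) →
               (∀ i → P i → Q i) → count P? ℕ.≤ count Q?
count-mono-≤ {zero}  P? Q? P⊆Q = z≤n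
count-mono-≤ {suc n} P? Q? P⊆Q =
  ℕ.+-mono-≤ (⟦⟧-mono (P? zero) (Q? zero) (P⊆Q zero)) (count-mono-≤ (P? ∘ suc) (Q? ∘ suc) (P⊆Q ∘ suc))

count-mono-< : ∀ {P Q : Pred (Fin n) 0ℓ} (P? : Decidable P) (Q? : Decidable Q) →
               (∀ i → P i → Q i) → ∀ j → Q j → ¬ P j → count P? ℕ.< count Q?
count-mono-< P? Q? P⊆Q zero    q ¬p =
  ℕ.+-mono-<-≤ (subst (ℕ._< ⟦ Q? zero ⟧) (sym (⟦⟧-false {d = P? zero} ¬p))
                 (ℕ.≤-reflexive (sym (⟦⟧-true {d = Q? zero} q))))
               (count-mono-≤ (P? ∘ suc) (Q? ∘ suc) (P⊆Q ∘ suc))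
count-mono-< P? Q? P⊆Q (suc j) q ¬p =
  ℕ.+-mono-≤-< (⟦⟧-mono (P? zero) (Q? zero) (P⊆Q zero)) (count-mono-< (P? ∘ suc) (Q? ∘ suc) (P⊆Q ∘ suc) j q ¬p)

count-≟ : ∀ (y : Fin n) → count (Fin._≟ y) ≡ 1
count-≟ {suc n} zero    = cong suc (∑ℕ.sum-replicate-zero n)
count-≟         (suc y) = count-≟ y

module _ (P : UnitIntervalOrder n) where
  open UnitIntervalOrder P
  open Poset poset using ()
    renaming (refl to ≼-refl; reflexive to ≼-reflexive; trans to ≼-trans; antisym to ≼-antisym)

  ≼-≺-trans : ∀ {x y z} → x ≼ y → y ≺ z → x ≺ z
  ≼-≺-trans x≼y (y≼z , y≢z) =
    ≼-trans x≼y y≼z , λ { refl → y≢z (≼-antisym y≼z x≼y) }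

  ≺-≼-trans : ∀ {x y z} → x ≺ y → y ≼ z → x ≺ z
  ≺-≼-trans (x≼y , x≢y) y≼z =
    ≼-trans x≼y y≼z , λ { refl → x≢y (≼-antisym x≼y y≼z) }

  ≺⇒⋡ : ∀ {x y} → x ≺ y → ¬ y ≼ x
  ≺⇒⋡ (x≼y , x≢y) y≼x = x≢y (≼-antisym x≼y y≼x)

  ≼-cases : ∀ {x y} → x ≼ y → x ≺ y ⊎ x ≡ y
  ≼-cases {x} {y} x≼y with x Fin.≟ y
  ... | yes x≡y = inj₂ x≡y
  ... | no  x≢y = inj₁ (x≼y , x≢y)

  induced : ∀ (Q : Poset 0ℓ 0ℓ 0ℓ) (f : Poset.Carrier Q → Fin n) →
            (∀ {x y} → Poset._≤_ Q x y → f x ≼ f y) →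
            (∀ {x y} → f x ≼ f y → Poset._≤_ Q x y) → HasInduced poset Q
  induced Q f mono cancel = f , record
    { isOrderHomomorphism = record
      { cong = λ x≈y → ≼-antisym (mono (reflexive x≈y)) (mono (reflexive (Eq.sym x≈y)))
      ; mono = mono
      }
    ; injective = λ eq → antisym (cancel (≼-reflexive eq)) (cancel (≼-reflexive (sym eq)))
    ; cancel    = cancel
    }
    where
    open Poset Q using (reflexive; antisym; module Eq)

  3+1-impossible : ∀ {a b c d} → a ≺ b → b ≺ c →
                   Incomparable a d → Incomparable b d → Incomparable c d → ⊥
  3+1-impossible {a} {b} {c} {d} a≺b b≺c (a⋠d , d⋠a) (b⋠d , d⋠b) (c⋠d , d⋠c) =
    3+1-free (induced (⊎-poset (chain 3) (chain 1)) f mono cancel)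
    where
    f : Fin 3 ⊎ Fin 1 → Fin n
    f (inj₁ zero)             = a
    f (inj₁ (suc zero))       = b
    f (inj₁ (suc (suc zero))) = c
    f (inj₂ zero)             = d

    open Poset (⊎-poset (chain 3) (chain 1)) using (_≤_)

    mono : ∀ {x y} → x ≤ y → f x ≼ f y
    mono {inj₁ zero} {inj₁ zero} _ = ≼-refl
    mono {inj₁ zero} {inj₁ (suc zero)} _ = proj₁ a≺b
    mono {inj₁ zero} {inj₁ (suc (suc zero))} _ = ≼-trans (proj₁ a≺b) (proj₁ b≺c)
    mono {inj₁ (suc zero)} {inj₁ zero} (Pointwise.inj₁ ())
    mono {inj₁ (suc zero)} {inj₁ (suc zero)} _ = ≼-refl
    mono {inj₁ (suc zero)} {inj₁ (suc (suc zero))} _ = proj₁ b≺c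
    mono {inj₁ (suc (suc zero))} {inj₁ zero} (Pointwise.inj₁ ())
    mono {inj₁ (suc (suc zero))} {inj₁ (suc zero)} (Pointwise.inj₁ (s≤s ()))
    mono {inj₁ (suc (suc zero))} {inj₁ (suc (suc zero))} _ = ≼-refl
    mono {inj₂ zero} {inj₂ zero} _ = ≼-refl

    cancel : ∀ {x y} → f x ≼ f y → x ≤ y
    cancel {inj₁ zero} {inj₁ _} _ = Pointwise.inj₁ z≤n
    cancel {inj₁ (suc zero)} {inj₁ zero} p = contradiction p (≺⇒⋡ a≺b)
    cancel {inj₁ (suc zero)} {inj₁ (suc _)} _ = Pointwise.inj₁ (s≤s z≤n)
    cancel {inj₁ (suc (suc zero))} {inj₁ zero} p = contradiction p (≺⇒⋡ (≺-≼-trans a≺b (proj₁ b≺c)))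
    cancel {inj₁ (suc (suc zero))} {inj₁ (suc zero)} p = contradiction p (≺⇒⋡ b≺c)
    cancel {inj₁ (suc (suc zero))} {inj₁ (suc (suc zero))} _ = Pointwise.inj₁ (s≤s (s≤s z≤n))
    cancel {inj₁ zero} {inj₂ zero} p = contradiction p a⋠d
    cancel {inj₁ (suc zero)} {inj₂ zero} p = contradiction p b⋠d
    cancel {inj₁ (suc (suc zero))} {inj₂ zero} p = contradiction p c⋠d
    cancel {inj₂ zero} {inj₁ zero} p = contradiction p d⋠a
    cancel {inj₂ zero} {inj₁ (suc zero)} p = contradiction p d⋠b
    cancel {inj₂ zero} {inj₁ (suc (suc zero))} p = contradiction p d⋠c
    cancel {inj₂ zero} {inj₂ zero} _ = Pointwise.inj₂ z≤n

  2+2-impossible : ∀ {a b c d} → a ≺ b → c ≺ d →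
                   Incomparable a c → Incomparable a d → Incomparable b c → Incomparable b d → ⊥
  2+2-impossible {a} {b} {c} {d} a≺b c≺d (a⋠c , c⋠a) (a⋠d , d⋠a) (b⋠c , c⋠b) (b⋠d , d⋠b) =
    2+2-free (induced (⊎-poset (chain 2) (chain 2)) f mono cancel)
    where
    f : Fin 2 ⊎ Fin 2 → Fin n
    f (inj₁ zero)       = a
    f (inj₁ (suc zero)) = b
    f (inj₂ zero)       = c
    f (inj₂ (suc zero)) = d

    open Poset (⊎-poset (chain 2) (chain 2)) using (_≤_)

    mono : ∀ {x y} → x ≤ y → f x ≼ f y
    mono {inj₁ zero} {inj₁ zero} _ = ≼-refl
    mono {inj₁ zero} {inj₁ (suc zero)} _ = proj₁ a≺b
    mono {inj₁ (suc zero)} {inj₁ zero} (Pointwise.inj₁ ())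
    mono {inj₁ (suc zero)} {inj₁ (suc zero)} _ = ≼-refl
    mono {inj₂ zero} {inj₂ zero} _ = ≼-refl
    mono {inj₂ zero} {inj₂ (suc zero)} _ = proj₁ c≺d
    mono {inj₂ (suc zero)} {inj₂ zero} (Pointwise.inj₂ ())
    mono {inj₂ (suc zero)} {inj₂ (suc zero)} _ = ≼-refl

    cancel : ∀ {x y} → f x ≼ f y → x ≤ y
    cancel {inj₁ zero} {inj₁ _} _ = Pointwise.inj₁ z≤n
    cancel {inj₁ (suc zero)} {inj₁ zero} p = contradiction p (≺⇒⋡ a≺b)
    cancel {inj₁ (suc zero)} {inj₁ (suc zero)} _ = Pointwise.inj₁ (s≤s z≤n)
    cancel {inj₂ zero} {inj₂ _} _ = Pointwise.inj₂ z≤n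
    cancel {inj₂ (suc zero)} {inj₂ zero} p = contradiction p (≺⇒⋡ c≺d)
    cancel {inj₂ (suc zero)} {inj₂ (suc zero)} _ = Pointwise.inj₂ (s≤s z≤n)
    cancel {inj₁ zero} {inj₂ zero} p = contradiction p a⋠c
    cancel {inj₁ zero} {inj₂ (suc zero)} p = contradiction p a⋠d
    cancel {inj₁ (suc zero)} {inj₂ zero} p = contradiction p b⋠c
    cancel {inj₁ (suc zero)} {inj₂ (suc zero)} p = contradiction p b⋠d
    cancel {inj₂ zero} {inj₁ zero} p = contradiction p c⋠a
    cancel {inj₂ zero} {inj₁ (suc zero)} p = contradiction p c⋠b
    cancel {inj₂ (suc zero)} {inj₁ zero} p = contradiction p d⋠a
    cancel {inj₂ (suc zero)} {inj₁ (suc zero)} p = contradiction p d⋠b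

  -- If both fail, any comparability between the chains i ≺ j and x ≺ y would compose to one of the
  -- two relations, so the chains induce a forbidden 2+2.
  2+2-cross : ∀ {i j x y} → i ≺ j → x ≺ y → i ≺ y ⊎ x ≺ j
  2+2-cross {i} {j} {x} {y} i≺j x≺y with i ≺? y | x ≺? j
  ... | yes i≺y | _       = inj₁ i≺y
  ... | no _    | yes x≺j = inj₂ x≺j
  ... | no i⊀y  | no x⊀j  = ⊥-elim (2+2-impossible i≺j x≺y
    ((λ i≼x → i⊀y (≼-≺-trans i≼x x≺y)) , (λ x≼i → x⊀j (≼-≺-trans x≼i i≺j)))
    ((λ i≼y → [ i⊀y , (λ { refl → x⊀j (≺-≼-trans x≺y (proj₁ i≺j)) }) ]′ (≼-cases i≼y)) ,
     (λ y≼i → x⊀j (≺-≼-trans x≺y (≼-trans y≼i (proj₁ i≺j)))))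
    ((λ j≼x → i⊀y (≺-≼-trans i≺j (≼-trans j≼x (proj₁ x≺y)))) ,
     (λ x≼j → [ x⊀j , (λ { refl → i⊀y (≺-≼-trans i≺j (proj₁ x≺y)) }) ]′ (≼-cases x≼j)))
    ((λ j≼y → i⊀y (≺-≼-trans i≺j j≼y)) , (λ y≼j → x⊀j (≺-≼-trans x≺y y≼j))))

  -- If both fail, x is incomparable to all of i, j, k, since any comparability would compose to one
  -- of the two relations; this is a forbidden 3+1.
  3+1-cross : ∀ {i j k} → i ≺ j → j ≺ k → ∀ x → i ≺ x ⊎ x ≺ k
  3+1-cross {i} {j} {k} i≺j j≺k x with i ≺? x | x ≺? k
  ... | yes i≺x | _       = inj₁ i≺x
  ... | no _    | yes x≺k = inj₂ x≺k
  ... | no i⊀x  | no x⊀k  = ⊥-elim (3+1-impossible i≺j j≺k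
    ((λ i≼x → [ i⊀x , (λ { refl → x⊀k (≺-≼-trans i≺j (proj₁ j≺k)) }) ]′ (≼-cases i≼x)) ,
     (λ x≼i → x⊀k (≼-≺-trans x≼i (≺-≼-trans i≺j (proj₁ j≺k)))))
    ((λ j≼x → i⊀x (≺-≼-trans i≺j j≼x)) , (λ x≼j → x⊀k (≼-≺-trans x≼j j≺k)))
    ((λ k≼x → i⊀x (≺-≼-trans i≺j (≼-trans (proj₁ j≺k) k≼x))) ,
     (λ x≼k → [ x⊀k , (λ { refl → i⊀x (≺-≼-trans i≺j (proj₁ j≺k)) }) ]′ (≼-cases x≼k))))

  down up : Fin n → ℕ
  down y = count λ x → x ≺? y
  up   y = count λ z → y ≺? z

  #≼ : ∀ {Q R : Pred (Fin n) 0ℓ} (Q? : Decidable Q) (R? : Decidable R) y →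
       (∀ x → ⟦ Q? x ⟧ ≡ ⟦ x Fin.≟ y ⟧ ℕ.+ ⟦ R? x ⟧) → # Q? ≡ suc (count R?)
  #≼ Q? R? y eq = trans (#≡count Q?) (trans (∑ℕ.sum-cong-≗ eq)
    (trans (∑ℕ.∑-distrib-+ (λ x → ⟦ x Fin.≟ y ⟧) (λ x → ⟦ R? x ⟧)) (cong (ℕ._+ count R?) (count-≟ y))))

  -- The counts in `β` are weak, and each `suc` is the point y itself.
  β≡ : ∀ y → β y ≡ ℤ.+ suc (down y) - ℤ.+ suc (up y)
  β≡ y = cong₂ (λ a b → ℤ.+ a - ℤ.+ b) (#≼ (_≼? y) (_≺? y) y below-y) (#≼ (y ≼?_) (y ≺?_) y above-y)
    where
    below-y : ∀ x → ⟦ x ≼? y ⟧ ≡ ⟦ x Fin.≟ y ⟧ ℕ.+ ⟦ x ≺? y ⟧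
    below-y x with x ≼? y | x Fin.≟ y
    ... | yes _ | yes _    = refl
    ... | yes _ | no _     = refl
    ... | no ⋠  | yes refl = contradiction ≼-refl ⋠
    ... | no _  | no _     = refl
    above-y : ∀ x → ⟦ y ≼? x ⟧ ≡ ⟦ x Fin.≟ y ⟧ ℕ.+ ⟦ y ≺? x ⟧
    above-y x with y ≼? x | x Fin.≟ y | y Fin.≟ x
    ... | yes _ | yes _    | yes _    = refl
    ... | yes _ | no _     | no _     = refl
    ... | no ⋠  | yes refl | _        = contradiction ≼-refl ⋠
    ... | no _  | no _     | _        = refl
    ... | yes _ | yes refl | no ≢     = contradiction refl ≢
    ... | yes _ | no ≢     | yes refl = contradiction refl ≢

  β-< : ∀ {y z} → down y ℕ.≤ down z → up z ℕ.≤ up y → down y ℕ.< down z ⊎ up z ℕ.< up y → β y ℤ.< β z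
  β-< {y} {z} d u strict =
    subst (ℤ._< β z) (sym (β≡ y)) (subst (_ ℤ.<_) (sym (β≡ z)) (go strict))
    where
    go : down y ℕ.< down z ⊎ up z ℕ.< up y →
         ℤ.+ suc (down y) - ℤ.+ suc (up y) ℤ.< ℤ.+ suc (down z) - ℤ.+ suc (up z)
    go (inj₁ d<) = ℤ.+-mono-<-≤ (ℤ.+<+ (s≤s d<)) (ℤ.neg-mono-≤ (ℤ.+≤+ (s≤s u)))
    go (inj₂ u<) = ℤ.+-mono-≤-< (ℤ.+≤+ (s≤s d)) (ℤ.neg-mono-< (ℤ.+<+ (s≤s u<)))

  -- If a rule failed, the point with the smaller label would have the strictly larger β. For the
  -- monotonicity rules, `2+2-cross` makes the up-sets (respectively down-sets) of the two points
  -- strictly nested, with the other end of the given relation as witness, and `3+1-cross` nests the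
  -- sets on the other side the opposite way.
  hessenberg : WellLabeled P → Hessenberg n
  hessenberg labeled = record
    { _≺_     = _≺_
    ; _≺?_    = _≺?_
    ; ≺⇒<     = λ {i} {j} i≺j → ℕ.≰⇒> λ j≤i → ℤ.<⇒≱
        (β-< (count-mono-≤ (_≺? i) (_≺? j) λ x x≺i → ≺-≼-trans x≺i (proj₁ i≺j))
             (count-mono-≤ (j ≺?_) (i ≺?_) λ x j≺x → ≼-≺-trans (proj₁ i≺j) j≺x)
             (inj₁ (count-mono-< (_≺? i) (_≺? j) (λ x x≺i → ≺-≼-trans x≺i (proj₁ i≺j)) i i≺j λ (_ , ≢) → ≢ refl)))
        (labeled j i j≤i)
    ; ≺-monoˡ = λ {i′} {i} {j} i′≤i i≺j → decidable-stable (i′ ≺? j) λ i′⊀j → ℤ.<⇒≱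
        (β-< (count-mono-≤ (_≺? i) (_≺? i′) λ x x≺i → [ id , (λ i′≺j → contradiction i′≺j i′⊀j) ]′ (3+1-cross x≺i i≺j i′))
             (ℕ.<⇒≤ (above i′⊀j i≺j)) (inj₂ (above i′⊀j i≺j)))
        (labeled i′ i i′≤i)
    ; ≺-monoʳ = λ {i} {j} {j′} i≺j j≤j′ → decidable-stable (i ≺? j′) λ i⊀j′ → ℤ.<⇒≱
        (β-< (ℕ.<⇒≤ (beneath i⊀j′ i≺j))
             (count-mono-≤ (j ≺?_) (j′ ≺?_) λ y j≺y → [ (λ i≺j′ → contradiction i≺j′ i⊀j′) , id ]′ (3+1-cross i≺j j≺y j′))
             (inj₁ (beneath i⊀j′ i≺j)))
        (labeled j j′ j≤j′)
    }
    where
    above : ∀ {i′ i j} → ¬ i′ ≺ j → i ≺ j → up i′ ℕ.< up i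
    above {i′} {i} {j} i′⊀j i≺j = count-mono-< (i′ ≺?_) (i ≺?_)
      (λ y i′≺y → [ id , (λ i′≺j → contradiction i′≺j i′⊀j) ]′ (2+2-cross i≺j i′≺y)) j i≺j i′⊀j
    beneath : ∀ {i j j′} → ¬ i ≺ j′ → i ≺ j → down j′ ℕ.< down j
    beneath {i} {j} {j′} i⊀j′ i≺j = count-mono-< (_≺? j′) (_≺? j)
      (λ x x≺j′ → [ (λ i≺j′ → contradiction i≺j′ i⊀j′) , id ]′ (2+2-cross i≺j x≺j′)) i i≺j i⊀j′

-- Excedance-free permutations by their first letter

infix 3 _when_
_when_ : ℤ → Dec A → ℤ
x when d = if does d then x else 0ℤ

when-true : ∀ {d : Dec A} {x} → A → (x when d) ≡ x
when-true {d = d} {x} a = cong (if_then x else 0ℤ) (dec-true d a)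

when-false : ∀ {d : Dec A} {x} → ¬ A → (x when d) ≡ 0ℤ
when-false {d = d} {x} ¬a = cong (if_then x else 0ℤ) (dec-false d ¬a)

does-⇔ : ∀ (a : Dec A) (b : Dec B) → (A → B) → (B → A) → does a ≡ does b
does-⇔ (yes a) b to from = sym (dec-true b (to a))
does-⇔ (no ¬a) b to from = sym (dec-false b (¬a ∘ from))

when-⇔ : ∀ (a : Dec A) (b : Dec B) x → (A → B) → (B → A) → (x when a) ≡ (x when b)
when-⇔ a b x to from = cong (if_then x else 0ℤ) (does-⇔ a b to from)

⟦⟧-⇔ : ∀ (a : Dec A) (b : Dec B) → (A → B) → (B → A) → ⟦ a ⟧ ≡ ⟦ b ⟧
⟦⟧-⇔ a b to from = cong (if_then 1 else 0) (does-⇔ a b to from)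

when-× : ∀ (a : Dec A) (b : Dec B) x → (x when (a ×-dec b)) ≡ ((x when b) when a)
when-× a b x with does a
... | true  = refl
... | false = refl

when-+ : ∀ (d : Dec A) x y → (x + y when d) ≡ (x when d) + (y when d)
when-+ d x y with does d
... | true  = refl
... | false = refl

sum-zero : ∀ {f : Fin n → ℤ} → (∀ i → f i ≡ 0ℤ) → sum f ≡ 0ℤ
sum-zero {n} eq = trans (sum-cong-≗ {n} eq) (sum-replicate-zero n)

sum-when : ∀ (f : Fin n → ℤ) (d : Dec A) → sum (λ i → f i when d) ≡ (sum f when d)
sum-when {n} f d with does d
... | true  = refl
... | false = sum-replicate-zero n

∑ˡ-tabulate : ∀ (h : Fin n → A) (f : A → ℤ) → ∑ˡ (List.tabulate h) f ≡ sum (f ∘ h)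
∑ˡ-tabulate {zero}  h f = refl
∑ˡ-tabulate {suc n} h f = cong (f (h zero) +_) (∑ˡ-tabulate (h ∘ suc) f)

∑ˡ-filter : ∀ {P : Pred A 0ℓ} (P? : Decidable P) xs (f : A → ℤ) →
            ∑ˡ (filter P? xs) f ≡ ∑ˡ xs (λ x → f x when P? x)
∑ˡ-filter P? []       f = refl
∑ˡ-filter P? (x ∷ xs) f with does (P? x)
... | true  = cong (f x +_) (∑ˡ-filter P? xs f)
... | false = trans (∑ˡ-filter P? xs f) (sym (ℤ.+-identityˡ _))

∑ˡ-+ : ∀ (xs : List A) (f g : A → ℤ) → ∑ˡ xs (λ x → f x + g x) ≡ ∑ˡ xs f + ∑ˡ xs g
∑ˡ-+ []       f g = refl
∑ˡ-+ (x ∷ xs) f g =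
  trans (cong (f x + g x +_) (∑ˡ-+ xs f g)) (interchange ℤ.+-commutativeSemigroup (f x) (g x) _ _)

∑ˡ-sum : ∀ (xs : List A) (f : Fin n → A → ℤ) → sum (λ i → ∑ˡ xs (f i)) ≡ ∑ˡ xs λ x → sum λ i → f i x
∑ˡ-sum {n = zero}  xs f = sym (∑ˡ-zero xs)
∑ˡ-sum {n = suc n} xs f =
  trans (cong (∑ˡ xs (f zero) +_) (∑ˡ-sum xs (f ∘ suc))) (sym (∑ˡ-+ xs (f zero) _))

∑< : ℕ → (ℕ → ℤ) → ℤ
∑< n h = sum {n} (h ∘ toℕ)

∑<-cong : ∀ n {h h′ : ℕ → ℤ} → (∀ i → h i ≡ h′ i) → ∑< n h ≡ ∑< n h′
∑<-cong n eq = sum-cong-≗ {n} (eq ∘ toℕ)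

∑<-+ : ∀ n (h h′ : ℕ → ℤ) → ∑< n (λ i → h i + h′ i) ≡ ∑< n h + ∑< n h′
∑<-+ n h h′ = ∑-distrib-+ {n} (h ∘ toℕ) (h′ ∘ toℕ)

-- A downward closed predicate holds exactly on the initial segment whose length is its count.
sum-initial : ∀ {P : Pred (Fin n) 0ℓ} (P? : Decidable P) → (∀ {i j} → i Fin.≤ j → P j → P i) →
              ∀ (h : ℕ → ℤ) → sum (λ i → h (toℕ i) when P? i) ≡ ∑< (count P?) h
sum-initial {zero}  P? closed h = refl
sum-initial {suc n} P? closed h with P? zero
... | yes _ = cong (h 0 +_) (sum-initial (P? ∘ suc) (λ i≤j → closed (s≤s i≤j)) (h ∘ suc))
... | no ¬p = trans (ℤ.+-identityˡ _)
  (trans (sum-zero {n} λ i → when-false {d = P? (suc i)} (¬p ∘ closed z≤n))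
         (sym (cong (λ k → ∑< k h)
           (trans (∑ℕ.sum-cong-≗ {n} λ i → ⟦⟧-false {d = P? (suc i)} (¬p ∘ closed z≤n))
                  (∑ℕ.sum-replicate-zero n)))))

module _ (H : Hessenberg (suc n)) where
  open Hessenberg H

  restrict : Hessenberg n
  restrict = record
    { _≺_     = λ i j → suc i ≺ suc j
    ; _≺?_    = λ i j → suc i ≺? suc j
    ; ≺⇒<     = ℕ.s≤s⁻¹ ∘ ≺⇒<
    ; ≺-monoˡ = ≺-monoˡ ∘ s≤s
    ; ≺-monoʳ = λ i≺j j≤j′ → ≺-monoʳ i≺j (s≤s j≤j′)
    }

  -- A point with a larger label cannot lie below the first one, so being incomparable to it amounts
  -- to not being above it.
  neighbour? : ∀ j → Dec (¬ zero ≺ suc j)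
  neighbour? j = ¬? (zero ≺? suc j)

  degree : ℕ
  degree = count neighbour?

-- A polynomial in q is represented by the functional g : ℕ → ℤ applied to its
-- exponents; this is multiplication by 1 + q + ⋯ + q^d.
[1+_]·_ : ℕ → (ℕ → ℤ) → ℕ → ℤ
([1+ d ]· g) s = ∑< (suc d) λ r → g (r ℕ.+ s)

count-punchIn : ∀ (i : Fin (suc n)) → count (λ x → punchIn i x Fin.<? i) ≡ toℕ i
count-punchIn {n}     zero    = ∑ℕ.sum-replicate-zero n
count-punchIn {suc n} (suc i) = cong suc (count-punchIn i)

inversions-⇔ : ∀ {f g : Fin n → ℕ} → (∀ i j → f i ℕ.< f j → g i ℕ.< g j) →
               (∀ i j → g i ℕ.< g j → f i ℕ.< f j) → inversions f ≡ inversions g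
inversions-⇔ {zero}          to from = refl
inversions-⇔ {suc n} {f} {g} to from =
  cong₂ ℕ._+_ (∑ℕ.sum-cong-≗ {n} λ j →
                 ⟦⟧-⇔ (f (suc j) ℕ.<? f zero) (g (suc j) ℕ.<? g zero) (to (suc j) zero) (from (suc j) zero))
              (inversions-⇔ (λ i j → to (suc i) (suc j)) (λ i j → from (suc i) (suc j)))

punchIn-mono-< : ∀ i {j k : Fin n} → j Fin.< k → punchIn i j Fin.< punchIn i k
punchIn-mono-< i {j} {k} j<k = ℕ.≰⇒> λ le → ℕ.<⇒≱ j<k (Fin.punchIn-cancel-≤ i k j le)

punchIn-cancel-< : ∀ i {j k : Fin n} → punchIn i j Fin.< punchIn i k → j Fin.< k
punchIn-cancel-< i {j} {k} lt = ℕ.≰⇒> λ k≤j → ℕ.<⇒≱ lt (Fin.punchIn-mono-≤ i k j k≤j)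

punchIn-≤-suc : ∀ i (j : Fin n) → punchIn i j Fin.≤ suc j
punchIn-≤-suc zero    j       = ℕ.≤-refl
punchIn-≤-suc (suc i) zero    = z≤n
punchIn-≤-suc (suc i) (suc j) = s≤s (punchIn-≤-suc i j)

punchIn-cases : ∀ i (j : Fin n) → suc j Fin.≤ i ⊎ punchIn i j ≡ suc j
punchIn-cases zero    j       = inj₂ refl
punchIn-cases (suc i) zero    = inj₁ (s≤s z≤n)
punchIn-cases (suc i) (suc j) = [ inj₁ ∘ s≤s , inj₂ ∘ cong suc ]′ (punchIn-cases i j)

-- The first letter i exceeds exactly i later letters, and `punchIn i` keeps the relative order of
-- the others.
inversions-insert : ∀ i (π : Permutation′ n) →
  inversions (toℕ ∘ (insert zero i π ⟨$⟩ʳ_)) ≡ toℕ i ℕ.+ inversions (toℕ ∘ (π ⟨$⟩ʳ_))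
inversions-insert i π = cong₂ ℕ._+_
  (trans (sym (∑ℕ.sum-permute (λ x → ⟦ punchIn i x Fin.<? i ⟧) π)) (count-punchIn i))
  (inversions-⇔ (λ j k → punchIn-cancel-< i {π ⟨$⟩ʳ j} {π ⟨$⟩ʳ k}) (λ j k → punchIn-mono-< i {π ⟨$⟩ʳ j} {π ⟨$⟩ʳ k}))

module _ (H : Hessenberg (suc n)) where
  open Hessenberg H

  insert-nonExcedant : ∀ i π → ¬ zero ≺ i → Hessenberg.NonExcedant (restrict H) π → NonExcedant (insert zero i π)
  insert-nonExcedant i π 0⊀i free (zero , 0≺)   = 0⊀i 0≺
  insert-nonExcedant i π 0⊀i free (suc j , j≺) = free (j , ≺-monoʳ j≺ (punchIn-≤-suc i _))

  -- Where `punchIn i` leaves a letter lower than its successor, an excedance of the pattern could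
  -- disappear. But then that successor is at most i, and the excedance would give 0 ≺ i.
  nonExcedant-insert : ∀ i π → NonExcedant (insert zero i π) → ¬ zero ≺ i × Hessenberg.NonExcedant (restrict H) π
  nonExcedant-insert i π free = 0⊀i , λ (j , j≺) →
    [ (λ le → 0⊀i (≺-monoˡ z≤n (≺-monoʳ j≺ le))) ,
      (λ eq → free (suc j , subst (suc j ≺_) (sym eq) j≺)) ]′ (punchIn-cases i (π ⟨$⟩ʳ j))
    where
    0⊀i : ¬ zero ≺ i
    0⊀i 0≺i = free (zero , 0≺i)

nonExcedantSum : Hessenberg n → (ℕ → ℤ) → ℤ
nonExcedantSum {n} H g =
  ∑ˡ (permutations n) λ U → g (inversions (toℕ ∘ (U ⟨$⟩ʳ_))) when Hessenberg.nonExcedant? H U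

nonExcedantSum-suc : ∀ (H : Hessenberg (suc n)) g →
                     nonExcedantSum H g ≡ nonExcedantSum (restrict H) ([1+ degree H ]· g)
nonExcedantSum-suc {n} H g = begin
  nonExcedantSum H g
    ≡⟨ ∑ˡ-cartesianProductWith (insert zero) (allFin (suc n)) (permutations n) summand ⟩
  ∑ˡ (allFin (suc n)) (λ i → ∑ˡ (permutations n) λ π → summand (insert zero i π))
    ≡⟨ ∑ˡ-tabulate id (λ i → ∑ˡ (permutations n) λ π → summand (insert zero i π)) ⟩
  sum {suc n} (λ i → ∑ˡ (permutations n) λ π → summand (insert zero i π))
    ≡⟨ ∑ˡ-sum (permutations n) (λ i π → summand (insert zero i π)) ⟩
  ∑ˡ (permutations n) (λ π → sum {suc n} λ i → summand (insert zero i π))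
    ≡⟨ ∑ˡ-cong (permutations n) per-pattern ⟩
  nonExcedantSum (restrict H) ([1+ degree H ]· g) ∎
  where
  open ≡-Reasoning
  open Hessenberg H
  module H′ = Hessenberg (restrict H)

  summand : Permutation′ (suc n) → ℤ
  summand U = g (inversions (toℕ ∘ (U ⟨$⟩ʳ_))) when nonExcedant? U

  0⊀? : ∀ i → Dec (¬ zero ≺ i)
  0⊀? i = ¬? (zero ≺? i)

  -- The additional admissible letter is 0 itself.
  initial-count : count 0⊀? ≡ suc (degree H)
  initial-count = cong (ℕ._+ degree H) (⟦⟧-true {d = 0⊀? zero} λ 0≺0 → ℕ.<-irrefl refl (≺⇒< 0≺0))

  per-pattern : ∀ π → sum {suc n} (λ i → summand (insert zero i π)) ≡
                      (([1+ degree H ]· g) (inversions (toℕ ∘ (π ⟨$⟩ʳ_))) when H′.nonExcedant? π)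
  per-pattern π = begin
    sum {suc n} (λ i → summand (insert zero i π))
      ≡⟨ sum-cong-≗ {suc n} (λ i → trans
           (when-⇔ (nonExcedant? (insert zero i π)) (H′.nonExcedant? π ×-dec 0⊀? i) _
              (λ free → let (p , q) = nonExcedant-insert H i π free in q , p)
              (λ (q , p) → insert-nonExcedant H i π p q))
           (trans (when-× (H′.nonExcedant? π) (0⊀? i) _)
                  (cong (λ x → (g x when 0⊀? i) when H′.nonExcedant? π) (inversions-insert i π)))) ⟩
    sum {suc n} (λ i → (g (toℕ i ℕ.+ s) when 0⊀? i) when H′.nonExcedant? π)
      ≡⟨ sum-when {suc n} (λ i → g (toℕ i ℕ.+ s) when 0⊀? i) (H′.nonExcedant? π) ⟩
    (sum {suc n} (λ i → g (toℕ i ℕ.+ s) when 0⊀? i) when H′.nonExcedant? π)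
      ≡⟨ cong (_when H′.nonExcedant? π) (trans
           (sum-initial 0⊀? (λ i≤j 0⊀j 0≺i → 0⊀j (≺-monoʳ 0≺i i≤j)) (λ r → g (r ℕ.+ s)))
           (cong (λ k → ∑< k λ r → g (r ℕ.+ s)) initial-count)) ⟩
    (([1+ degree H ]· g) s when H′.nonExcedant? π) ∎
    where s = inversions (toℕ ∘ (π ⟨$⟩ʳ_))

-- Alternating sums over surjective colourings

∑ᵛ : ∀ n → (Vec (Fin m) n → ℤ) → ℤ
∑ᵛ zero    F = F []
∑ᵛ (suc n) F = sum λ c → ∑ᵛ n λ κ → F (c ∷ κ)

∑ᵛ-cong : ∀ n {F G : Vec (Fin m) n → ℤ} → (∀ κ → F κ ≡ G κ) → ∑ᵛ n F ≡ ∑ᵛ n G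
∑ᵛ-cong         zero    eq = eq []
∑ᵛ-cong {m = m} (suc n) eq = sum-cong-≗ {m} λ c → ∑ᵛ-cong n λ κ → eq (c ∷ κ)

∑ᵛ-zero : ∀ n {F : Vec (Fin m) n → ℤ} → (∀ κ → F κ ≡ 0ℤ) → ∑ᵛ n F ≡ 0ℤ
∑ᵛ-zero         zero    eq = eq []
∑ᵛ-zero {m = m} (suc n) eq = sum-zero {m} λ c → ∑ᵛ-zero n λ κ → eq (c ∷ κ)

∑ᵛ-+ : ∀ n (F G : Vec (Fin m) n → ℤ) → ∑ᵛ n (λ κ → F κ + G κ) ≡ ∑ᵛ n F + ∑ᵛ n G
∑ᵛ-+         zero    F G = refl
∑ᵛ-+ {m = m} (suc n) F G =
  trans (sum-cong-≗ {m} λ c → ∑ᵛ-+ n (F ∘ (c ∷_)) (G ∘ (c ∷_)))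
        (∑-distrib-+ {m} (λ c → ∑ᵛ n (F ∘ (c ∷_))) (λ c → ∑ᵛ n (G ∘ (c ∷_))))

∑ᵛ-sum : ∀ {k} n (F : Fin k → Vec (Fin m) n → ℤ) →
         ∑ᵛ n (λ κ → sum λ i → F i κ) ≡ sum λ i → ∑ᵛ n (F i)
∑ᵛ-sum {k = zero}  n F = ∑ᵛ-zero n λ _ → refl
∑ᵛ-sum {k = suc k} n F =
  trans (∑ᵛ-+ n (F zero) (λ κ → sum λ i → F (suc i) κ)) (cong (∑ᵛ n (F zero) +_) (∑ᵛ-sum n (F ∘ suc)))

-- `punchIn c` enumerates all colours other than c, so avoiding c is the same as being a vector over
-- one colour fewer.
∑ᵛ-avoid : ∀ n (c : Fin (suc m)) (F : Vec (Fin (suc m)) n → ℤ) →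
  ∑ᵛ n (λ κ → F κ when Fin.all? (λ i → ¬? (Vec.lookup κ i Fin.≟ c))) ≡ ∑ᵛ n (F ∘ Vec.map (punchIn c))
∑ᵛ-avoid         zero    c F = refl
∑ᵛ-avoid {m = m} (suc n) c F = begin
  sum (λ b → ∑ᵛ n λ κ → F (b ∷ κ) when avoids? (b ∷ κ))
    ≡⟨ sum-remove {i = c} (λ b → ∑ᵛ n λ κ → F (b ∷ κ) when avoids? (b ∷ κ)) ⟩
  ∑ᵛ n (λ κ → F (c ∷ κ) when avoids? (c ∷ κ)) +
  sum (λ b → ∑ᵛ n λ κ → F (punchIn c b ∷ κ) when avoids? (punchIn c b ∷ κ))
    ≡⟨ cong₂ _+_ (∑ᵛ-zero n λ κ → when-false {d = avoids? (c ∷ κ)} λ ≢c → ≢c zero refl)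
                 (sum-cong-≗ {m} λ b → trans (∑ᵛ-cong n λ κ →
                    when-⇔ (avoids? (punchIn c b ∷ κ)) (avoids? κ) (F (punchIn c b ∷ κ)) (_∘ suc)
                      λ { ≢c zero → Fin.punchInᵢ≢i c b ; ≢c (suc i) → ≢c i })
                    (∑ᵛ-avoid n c (F ∘ (punchIn c b ∷_)))) ⟩
  0ℤ + sum (λ b → ∑ᵛ n λ κ → F (punchIn c b ∷ Vec.map (punchIn c) κ))
    ≡⟨ ℤ.+-identityˡ _ ⟩
  ∑ᵛ (suc n) (F ∘ Vec.map (punchIn c)) ∎
  where
  open ≡-Reasoning
  avoids? : ∀ {n} (κ : Vec (Fin (suc m)) n) → Dec (∀ i → Vec.lookup κ i ≢ c)
  avoids? κ = Fin.all? λ i → ¬? (Vec.lookup κ i Fin.≟ c)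

Surjective : Vec (Fin m) n → Set
Surjective κ = ∀ c → ∃ λ i → Vec.lookup κ i ≡ c

surjective? : (κ : Vec (Fin m) n) → Dec (Surjective κ)
surjective? κ = Fin.all? λ c → Fin.any? λ i → Vec.lookup κ i Fin.≟ c

∑ˢ : ∀ m n → (Vec (Fin m) n → ℤ) → ℤ
∑ˢ m n F = ∑ᵛ n λ κ → F κ when surjective? κ

∑ˢ-cong : ∀ m n {F G : Vec (Fin m) n → ℤ} → (∀ κ → F κ ≡ G κ) → ∑ˢ m n F ≡ ∑ˢ m n G
∑ˢ-cong m n eq = ∑ᵛ-cong n λ κ → cong (_when surjective? κ) (eq κ)

∑ˢ-+ : ∀ m n (F G : Vec (Fin m) n → ℤ) → ∑ˢ m n (λ κ → F κ + G κ) ≡ ∑ˢ m n F + ∑ˢ m n G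
∑ˢ-+ m n F G = trans
  (∑ᵛ-cong n λ κ → when-+ (surjective? κ) (F κ) (G κ))
  (∑ᵛ-+ n (λ κ → F κ when surjective? κ) (λ κ → G κ when surjective? κ))

∑ˢ-sum : ∀ m n {k} (F : Fin k → Vec (Fin m) n → ℤ) →
         ∑ˢ m n (λ κ → sum λ i → F i κ) ≡ sum λ i → ∑ˢ m n (F i)
∑ˢ-sum m n F = trans (∑ᵛ-cong n λ κ → sym (sum-when (λ i → F i κ) (surjective? κ)))
                     (∑ᵛ-sum n (λ i κ → F i κ when surjective? κ))

∑ˢ-pigeonhole : ∀ m n F → n ℕ.< m → ∑ˢ m n F ≡ 0ℤ
∑ˢ-pigeonhole m n F n<m = ∑ᵛ-zero n λ κ → when-false {d = surjective? κ} λ surj →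
  ℕ.<⇒≱ n<m (Fin.injective⇒≤ {f = proj₁ ∘ surj} λ {c} {c′} eq →
    trans (sym (proj₂ (surj c))) (trans (cong (Vec.lookup κ) eq) (proj₂ (surj c′))))

-- A surjective colouring of n + 1 points restricts to the last n points either as a
-- surjective colouring, or as one that misses precisely the colour of the first point.
∑ˢ-suc : ∀ m n (F : Vec (Fin (suc m)) (suc n) → ℤ) →
  ∑ˢ (suc m) (suc n) F ≡ ∑ˢ (suc m) n (λ κ → sum λ c → F (c ∷ κ)) +
                         ∑ˢ m n (λ κ → sum λ c → F (c ∷ Vec.map (punchIn c) κ))
∑ˢ-suc m n F = begin
  sum (λ c → ∑ᵛ n λ κ → F (c ∷ κ) when surjective? (c ∷ κ))
    ≡⟨ sum-cong-≗ {suc m} (λ c → trans (∑ᵛ-cong n (split c)) (∑ᵛ-+ n (whole c) (part c))) ⟩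
  sum (λ c → ∑ˢ (suc m) n (F ∘ (c ∷_)) + ∑ᵛ n (part c))
    ≡⟨ ∑-distrib-+ {suc m} (λ c → ∑ˢ (suc m) n (F ∘ (c ∷_))) (λ c → ∑ᵛ n (part c)) ⟩
  sum (λ c → ∑ˢ (suc m) n (F ∘ (c ∷_))) + sum (λ c → ∑ᵛ n (part c))
    ≡⟨ cong₂ _+_ (sym (∑ˢ-sum (suc m) n (λ c κ → F (c ∷ κ))))
                 (trans (sum-cong-≗ {suc m} missing) (sym (∑ˢ-sum m n λ c κ → F (c ∷ Vec.map (punchIn c) κ)))) ⟩
  ∑ˢ (suc m) n (λ κ → sum λ c → F (c ∷ κ)) + ∑ˢ m n (λ κ → sum λ c → F (c ∷ Vec.map (punchIn c) κ)) ∎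
  where
  open ≡-Reasoning
  avoids? : ∀ c (κ : Vec (Fin (suc m)) n) → Dec (∀ i → Vec.lookup κ i ≢ c)
  avoids? c κ = Fin.all? λ i → ¬? (Vec.lookup κ i Fin.≟ c)

  others? : ∀ c (κ : Vec (Fin (suc m)) n) → Dec (∀ b → ∃ λ i → Vec.lookup κ i ≡ punchIn c b)
  others? c κ = Fin.all? λ b → Fin.any? λ i → Vec.lookup κ i Fin.≟ punchIn c b

  whole part : Fin (suc m) → Vec (Fin (suc m)) n → ℤ
  whole c κ = F (c ∷ κ) when surjective? κ
  part c κ  = (F (c ∷ κ) when others? c κ) when avoids? c κ

  surjective-others : ∀ c κ → Surjective (c ∷ κ) → ∀ b → ∃ λ i → Vec.lookup κ i ≡ punchIn c b
  surjective-others c κ surj b with surj (punchIn c b)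
  ... | zero  , eq = contradiction (sym eq) (Fin.punchInᵢ≢i c b)
  ... | suc i , eq = i , eq

  others-surjective : ∀ c κ → (∀ b → ∃ λ i → Vec.lookup κ i ≡ punchIn c b) → Surjective (c ∷ κ)
  others-surjective c κ others b with c Fin.≟ b
  ... | yes c≡b = zero , c≡b
  ... | no  c≢b = let (i , eq) = others (punchOut c≢b) in suc i , trans eq (Fin.punchIn-punchOut c≢b)

  surjective-tail : ∀ c κ → (∃ λ i → Vec.lookup κ i ≡ c) → Surjective (c ∷ κ) → Surjective κ
  surjective-tail c κ (i , eq) surj b with surj b
  ... | zero  , c≡b = i , trans eq c≡b
  ... | suc j , eq′ = j , eq′

  split : ∀ c κ → (F (c ∷ κ) when surjective? (c ∷ κ)) ≡
                  (F (c ∷ κ) when surjective? κ) + ((F (c ∷ κ) when others? c κ) when avoids? c κ)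
  split c κ with Fin.any? (λ i → Vec.lookup κ i Fin.≟ c)
  ... | yes (i , eq) = begin
    (F (c ∷ κ) when surjective? (c ∷ κ))
      ≡⟨ when-⇔ (surjective? (c ∷ κ)) (surjective? κ) (F (c ∷ κ))
           (surjective-tail c κ (i , eq)) (λ surj b → let (j , e) = surj b in suc j , e) ⟩
    (F (c ∷ κ) when surjective? κ)
      ≡⟨ ℤ.+-identityʳ _ ⟨
    (F (c ∷ κ) when surjective? κ) + 0ℤ
      ≡⟨ cong ((F (c ∷ κ) when surjective? κ) +_) (when-false {d = avoids? c κ} λ ≢c → ≢c i eq) ⟨
    _ ∎
  ... | no ∄i = begin
    (F (c ∷ κ) when surjective? (c ∷ κ))
      ≡⟨ when-⇔ (surjective? (c ∷ κ)) (others? c κ) (F (c ∷ κ)) (surjective-others c κ) (others-surjective c κ) ⟩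
    (F (c ∷ κ) when others? c κ)
      ≡⟨ when-true {d = avoids? c κ} (λ i eq → ∄i (i , eq)) ⟨
    ((F (c ∷ κ) when others? c κ) when avoids? c κ)
      ≡⟨ ℤ.+-identityˡ _ ⟨
    0ℤ + ((F (c ∷ κ) when others? c κ) when avoids? c κ)
      ≡⟨ cong (_+ ((F (c ∷ κ) when others? c κ) when avoids? c κ))
              (when-false {d = surjective? κ} λ surj → ∄i (surj c)) ⟨
    _ ∎

  missing : ∀ c → ∑ᵛ n (λ κ → (F (c ∷ κ) when others? c κ) when avoids? c κ) ≡
                  ∑ˢ m n (λ κ → F (c ∷ Vec.map (punchIn c) κ))
  missing c = trans (∑ᵛ-avoid n c λ κ → F (c ∷ κ) when others? c κ) (∑ᵛ-cong n λ κ →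
    when-⇔ (others? c (Vec.map (punchIn c) κ)) (surjective? κ) (F (c ∷ Vec.map (punchIn c) κ))
      (λ others b → let (i , eq) = others b in
         i , Fin.punchIn-injective c _ _ (trans (sym (Vec.lookup-map i (punchIn c) κ)) eq))
      (λ surj b → let (i , eq) = surj b in
         i , trans (Vec.lookup-map i (punchIn c) κ) (cong (punchIn c) eq)))

sign : ℕ → ℤ
sign zero    = 1ℤ
sign (suc k) = - sign k

sign-+ : ∀ a b → sign (a ℕ.+ b) ≡ sign a * sign b
sign-+ zero    b = sym (ℤ.*-identityˡ _)
sign-+ (suc a) b = trans (cong -_ (sign-+ a b)) (ℤ.neg-distribˡ-* (sign a) (sign b))

-- Inserting the first point as a new block preserves the sign (-1)^(n + m), inserting it
-- into an existing block reverses it.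
∑±-suc : ∀ n (F : ∀ m → Vec (Fin m) (suc n) → ℤ) (G : ∀ m → Vec (Fin m) n → ℤ) →
  (∀ m κ → sum (λ c → F (suc m) (c ∷ Vec.map (punchIn c) κ)) ≡ sum (λ c → F m (c ∷ κ)) + G m κ) →
  ∑< (suc (suc n)) (λ m → sign (suc n ℕ.+ m) * ∑ˢ m (suc n) (F m)) ≡
  ∑< (suc n) (λ m → sign (n ℕ.+ m) * ∑ˢ m n (G m))
∑±-suc n F G insertion = begin
  sign (suc n ℕ.+ 0) * 0ℤ + ∑< (suc n) (λ m → sign (suc n ℕ.+ suc m) * ∑ˢ (suc m) (suc n) (F (suc m)))
    ≡⟨ trans (cong (_+ ∑< (suc n) (λ m → sign (suc n ℕ.+ suc m) * ∑ˢ (suc m) (suc n) (F (suc m))))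
                   (ℤ.*-zeroʳ (sign (suc n ℕ.+ 0))))
             (ℤ.+-identityˡ _) ⟩
  ∑< (suc n) (λ m → sign (suc n ℕ.+ suc m) * ∑ˢ (suc m) (suc n) (F (suc m)))
    -- Colourings whose first point joins an existing block occur with m + 1 colours directly and
    -- with m colours through `insertion`, so the terms `old` telescope. Both ends vanish: with 0
    -- colours there is no block to join, and n points cannot occupy n + 1 colours.
    ≡⟨ ∑<-cong (suc n) step ⟩
  ∑< (suc n) (λ m → old (suc m) + (new m + - old m))
    ≡⟨ ∑<-+ (suc n) (old ∘ suc) (λ m → new m + - old m) ⟩
  ∑< (suc n) (old ∘ suc) + ∑< (suc n) (λ m → new m + - old m)
    ≡⟨ cong (∑< (suc n) (old ∘ suc) +_) (∑<-+ (suc n) new (λ m → - old m)) ⟩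
  ∑< (suc n) (old ∘ suc) + (∑< (suc n) new + ∑< (suc n) (λ m → - old m))
    ≡⟨ telescope (∑< (suc n) (old ∘ suc)) (∑< (suc n) new) (∑< (suc n) (λ m → - old m)) (∑<-telescope (suc n) old) ⟩
  (old (suc n) - old 0) + ∑< (suc n) new
    ≡⟨ cong (_+ ∑< (suc n) new) (cong₂ _-_ old-last old-first) ⟩
  0ℤ + ∑< (suc n) new
    ≡⟨ ℤ.+-identityˡ _ ⟩
  ∑< (suc n) new ∎
  where
  open ≡-Reasoning

  new : ℕ → ℤ
  new m = sign (n ℕ.+ m) * ∑ˢ m n (G m)

  oldˢ : ℕ → ℤ
  oldˢ m = ∑ˢ m n λ κ → sum λ c → F m (c ∷ κ)

  old : ℕ → ℤ
  old m = - (sign (n ℕ.+ m) * oldˢ m)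

  old-first : old 0 ≡ 0ℤ
  old-first = cong -_ (trans (cong (sign (n ℕ.+ 0) *_) (∑ᵛ-zero n λ κ → when-0 κ)) (ℤ.*-zeroʳ (sign (n ℕ.+ 0))))
    where
    when-0 : ∀ κ → (0ℤ when surjective? κ) ≡ 0ℤ
    when-0 κ with does (surjective? κ)
    ... | true  = refl
    ... | false = refl

  old-last : old (suc n) ≡ 0ℤ
  old-last = cong -_ (trans (cong (sign (n ℕ.+ suc n) *_) (∑ˢ-pigeonhole (suc n) n _ (ℕ.n<1+n n)))
                            (ℤ.*-zeroʳ (sign (n ℕ.+ suc n))))

  rearrange : ∀ s a b g → - (- s) * (a + (b + g)) ≡ - (- s * a) + (s * g + - (- (s * b)))
  rearrange = solve-∀

  step : ∀ m → sign (suc n ℕ.+ suc m) * ∑ˢ (suc m) (suc n) (F (suc m)) ≡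
               old (suc m) + (new m + - old m)
  step m = begin
    - sign (n ℕ.+ suc m) * ∑ˢ (suc m) (suc n) (F (suc m))
      ≡⟨ cong₂ _*_ (cong -_ flip) (trans (∑ˢ-suc m n (F (suc m)))
           (cong (oldˢ (suc m) +_) (trans (∑ˢ-cong m n (insertion m))
             (∑ˢ-+ m n (λ κ → sum λ c → F m (c ∷ κ)) (G m))))) ⟩
    - (- sign (n ℕ.+ m)) * (oldˢ (suc m) + (oldˢ m + ∑ˢ m n (G m)))
      ≡⟨ rearrange (sign (n ℕ.+ m)) (oldˢ (suc m)) (oldˢ m) (∑ˢ m n (G m)) ⟩
    - (- sign (n ℕ.+ m) * oldˢ (suc m)) + (new m + - old m)
      ≡⟨ cong (λ s → - (s * oldˢ (suc m)) + (new m + - old m)) (sym flip) ⟩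
    old (suc m) + (new m + - old m) ∎
    where
    flip : sign (n ℕ.+ suc m) ≡ - sign (n ℕ.+ m)
    flip = cong sign (ℕ.+-suc n m)

  ∑<-telescope : ∀ k (h : ℕ → ℤ) → ∑< k (h ∘ suc) + ∑< k (λ m → - h m) ≡ h k - h 0
  ∑<-telescope zero    h = sym (ℤ.+-inverseʳ (h 0))
  ∑<-telescope (suc k) h = trans
    (interchange ℤ.+-commutativeSemigroup (h 1) (∑< k (λ m → h (suc (suc m)))) (- h 0) (∑< k (λ m → - h (suc m))))
    (trans (cong ((h 1 - h 0) +_) (∑<-telescope k (h ∘ suc))) (cancel (h 1) (h 0) (h (suc k))))
    where
    cancel : ∀ a b c → (a - b) + (c - a) ≡ c - b
    cancel = solve-∀

  telescope : ∀ a b c {d} → a + c ≡ d → a + (b + c) ≡ d + b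
  telescope a b c refl = move a b c
    where
    move : ∀ a b c → a + (b + c) ≡ a + c + b
    move = solve-∀

-- Inserting the first point into a proper colouring

count-cong : ∀ {P Q : Pred (Fin n) 0ℓ} (P? : Decidable P) (Q? : Decidable Q) →
             (∀ i → P i → Q i) → (∀ i → Q i → P i) → count P? ≡ count Q?
count-cong P? Q? to from = ∑ℕ.sum-cong-≗ λ i → ⟦⟧-⇔ (P? i) (Q? i) (to i) (from i)

count-insert : ∀ {P Q : Pred (Fin n) 0ℓ} (P? : Decidable P) (Q? : Decidable Q) j → ¬ P j → Q j →
               (∀ i → i ≢ j → P i → Q i) → (∀ i → i ≢ j → Q i → P i) → count Q? ≡ suc (count P?)
count-insert P? Q? zero    ¬p q to from = cong₂ ℕ._+_ (⟦⟧-true {d = Q? zero} q)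
  (trans (count-cong (Q? ∘ suc) (P? ∘ suc) (λ i → from (suc i) λ ()) (λ i → to (suc i) λ ()))
         (cong (ℕ._+ count (P? ∘ suc)) (sym (⟦⟧-false {d = P? zero} ¬p))))
count-insert P? Q? (suc j) ¬p q to from = trans
  (cong₂ ℕ._+_ (⟦⟧-⇔ (Q? zero) (P? zero) (from zero λ ()) (to zero λ ()))
    (count-insert (P? ∘ suc) (Q? ∘ suc) j ¬p q (λ i i≢j → to (suc i) (i≢j ∘ Fin.suc-injective))
                                               (λ i i≢j → from (suc i) (i≢j ∘ Fin.suc-injective))))
  (ℕ.+-suc ⟦ P? zero ⟧ _)

module _ (H : Hessenberg n) (κ : Fin n → Fin m) where
  open Hessenberg H

  ProperColoring : Set
  ProperColoring = ∀ i j → i Fin.< j → ¬ i ≺ j → κ i ≢ κ j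

  properColoring? : Dec ProperColoring
  properColoring? = Fin.all? λ i → Fin.all? λ j → i Fin.<? j →-dec ¬? (i ≺? j) →-dec ¬? (κ i Fin.≟ κ j)

  colorInversions : ℕ
  colorInversions = ∑ℕ.sum λ i → count λ j → i Fin.<? j ×-dec ¬? (i ≺? j) ×-dec κ j Fin.<? κ i

colorWeight : Hessenberg n → (ℕ → ℤ) → Vec (Fin m) n → ℤ
colorWeight H g κ = g (colorInversions H (Vec.lookup κ)) when properColoring? H (Vec.lookup κ)

-- G c will be the number of neighbours coloured below c: the left side runs over the places
-- for a new block, the sum over A over the existing blocks without neighbours.
∑<-staircase : ∀ m (G : ℕ → ℕ) (g : ℕ → ℤ) {A : Pred (Fin m) 0ℓ} (A? : Decidable A) →
  (∀ c → A c → G (suc (toℕ c)) ≡ G (toℕ c)) →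
  (∀ c → ¬ A c → G (suc (toℕ c)) ≡ suc (G (toℕ c))) →
  ∑< (suc m) (g ∘ G) ≡
  sum (λ c → g (G (toℕ c)) when A? c) + ∑< (suc (count (¬? ∘ A?))) (λ r → g (r ℕ.+ G 0))
∑<-staircase zero    G g A? flat up = sym (ℤ.+-identityˡ _)
∑<-staircase (suc m) G g A? flat up
  with A? zero | ∑<-staircase m (G ∘ suc) g (A? ∘ suc) (flat ∘ suc) (up ∘ suc)
... | yes a | ih rewrite flat zero a =
  trans (cong (g (G 0) +_) ih) (sym (ℤ.+-assoc (g (G 0)) _ _))
-- At a free block the place before it matches the term of that block. At a taken one `G` rises, so
-- this place supplies the lowest exponent `G 0` and the remaining exponents start one higher.
... | no ¬a | ih rewrite up zero ¬a = trans (cong (g (G 0) +_) ih)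
  (trans (move (g (G 0)) (sum λ c → g (G (suc (toℕ c))) when A? (suc c)) _)
    (cong (λ x → 0ℤ + (sum λ c → g (G (suc (toℕ c))) when A? (suc c)) + (g (G 0) + x))
      (∑<-cong (suc (count (¬? ∘ A? ∘ suc))) λ r → cong g (ℕ.+-suc r (G 0)))))
  where
  move : ∀ a b c → a + (b + c) ≡ 0ℤ + b + (a + c)
  move = solve-∀

staircase-top : ∀ m (G : ℕ → ℕ) {A : Pred (Fin m) 0ℓ} (A? : Decidable A) →
  (∀ c → A c → G (suc (toℕ c)) ≡ G (toℕ c)) →
  (∀ c → ¬ A c → G (suc (toℕ c)) ≡ suc (G (toℕ c))) →
  G m ≡ count (¬? ∘ A?) ℕ.+ G 0
staircase-top zero    G A? flat up = refl
staircase-top (suc m) G A? flat up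
  with A? zero | staircase-top m (G ∘ suc) (A? ∘ suc) (flat ∘ suc) (up ∘ suc)
... | yes a | ih = trans ih (cong (count (¬? ∘ A? ∘ suc) ℕ.+_) (flat zero a))
... | no ¬a | ih = trans ih (trans (cong (count (¬? ∘ A? ∘ suc) ℕ.+_) (up zero ¬a))
                                   (ℕ.+-suc (count (¬? ∘ A? ∘ suc)) (G 0)))

module _ (H : Hessenberg (suc n)) where
  open Hessenberg H

  neighboursBelow : Vec (Fin m) n → ℕ → ℕ
  neighboursBelow κ c = count λ j → neighbour? H j ×-dec toℕ (Vec.lookup κ j) ℕ.<? c

  -- The neighbours of the first point form a clique.
  neighbours-distinct : ∀ (κ : Vec (Fin m) n) → ProperColoring (restrict H) (Vec.lookup κ) →
    ∀ {i j} → ¬ zero ≺ suc i → ¬ zero ≺ suc j → Vec.lookup κ i ≡ Vec.lookup κ j → i ≡ j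
  neighbours-distinct κ proper {i} {j} 0⊀i 0⊀j eq with Fin.<-cmp i j
  ... | tri< i<j _ _ = contradiction eq (proper i j i<j λ si≺sj → 0⊀j (≺-monoˡ z≤n si≺sj))
  ... | tri≈ _ i≡j _ = i≡j
  ... | tri> _ _ j<i = contradiction (sym eq) (proper j i j<i λ sj≺si → 0⊀i (≺-monoˡ z≤n sj≺si))

  Free : Vec (Fin m) n → Pred (Fin m) 0ℓ
  Free κ c = ¬ ∃ λ j → ¬ zero ≺ suc j × Vec.lookup κ j ≡ c

  free? : (κ : Vec (Fin m) n) → Decidable (Free κ)
  free? κ c = ¬? (Fin.any? λ j → neighbour? H j ×-dec Vec.lookup κ j Fin.≟ c)

  -- The inversions split by computation into those with the first point, which are its neighbours
  -- coloured below c, and the rest. Only the splitting of properness needs an argument.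
  colorWeight-∷ : ∀ g c (κ : Vec (Fin m) n) →
    colorWeight H g (c ∷ κ) ≡
    ((g (neighboursBelow κ (toℕ c) ℕ.+ colorInversions (restrict H) (Vec.lookup κ)) when free? κ c)
      when properColoring? (restrict H) (Vec.lookup κ))
  colorWeight-∷ g c κ = trans
    (when-⇔ (properColoring? H (Vec.lookup (c ∷ κ))) (properColoring? (restrict H) (Vec.lookup κ) ×-dec free? κ c) _
      (λ proper → (λ i j i<j → proper (suc i) (suc j) (s≤s i<j)) ,
                  (λ (j , 0⊀j , eq) → proper zero (suc j) (s≤s z≤n) 0⊀j (sym eq)))
      (λ { (proper , free) zero    (suc j) _         0⊀j eq → free (j , 0⊀j , sym eq)
         ; (proper , free) (suc i) (suc j) (s≤s i<j) → proper i j i<j }))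
    (when-× (properColoring? (restrict H) (Vec.lookup κ)) (free? κ c) _)

  module _ (κ : Vec (Fin m) n) (proper : ProperColoring (restrict H) (Vec.lookup κ)) where

    neighboursBelow-free : ∀ c → Free κ c → neighboursBelow κ (suc (toℕ c)) ≡ neighboursBelow κ (toℕ c)
    neighboursBelow-free c free = count-cong
      (λ j → neighbour? H j ×-dec toℕ (Vec.lookup κ j) ℕ.<? suc (toℕ c))
      (λ j → neighbour? H j ×-dec toℕ (Vec.lookup κ j) ℕ.<? toℕ c)
      (λ { j (0⊀j , s≤s le) → 0⊀j , ℕ.≤∧≢⇒< le λ eq → free (j , 0⊀j , Fin.toℕ-injective eq) })
      (λ j (0⊀j , lt) → 0⊀j , ℕ.m≤n⇒m≤1+n lt)

    neighboursBelow-taken : ∀ c → ¬ Free κ c → neighboursBelow κ (suc (toℕ c)) ≡ suc (neighboursBelow κ (toℕ c))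
    neighboursBelow-taken c ¬free
      with decidable-stable (Fin.any? λ j → neighbour? H j ×-dec Vec.lookup κ j Fin.≟ c) ¬free
    ... | k , 0⊀k , eq = count-insert
      (λ j → neighbour? H j ×-dec toℕ (Vec.lookup κ j) ℕ.<? toℕ c)
      (λ j → neighbour? H j ×-dec toℕ (Vec.lookup κ j) ℕ.<? suc (toℕ c))
      k (λ (_ , lt) → ℕ.<⇒≢ lt (cong toℕ eq)) (0⊀k , s≤s (ℕ.≤-reflexive (cong toℕ eq)))
      (λ j _ (0⊀j , lt) → 0⊀j , ℕ.m≤n⇒m≤1+n lt)
      (λ { j j≢k (0⊀j , s≤s le) → 0⊀j , ℕ.≤∧≢⇒< le λ e →
        j≢k (neighbours-distinct κ proper 0⊀j 0⊀k (trans (Fin.toℕ-injective e) (sym eq))) })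

    neighboursBelow-zero : neighboursBelow κ 0 ≡ 0
    neighboursBelow-zero = trans
      (∑ℕ.sum-cong-≗ {n} λ j → ⟦⟧-false {d = neighbour? H j ×-dec toℕ (Vec.lookup κ j) ℕ.<? 0} λ ())
      (∑ℕ.sum-replicate-zero n)

    -- `neighboursBelow κ` starts at 0, rises by one at each taken colour, and at the top has
    -- counted every neighbour.
    taken-count : count (¬? ∘ free? κ) ≡ degree H
    taken-count = begin
      count (¬? ∘ free? κ)                            ≡⟨ ℕ.+-identityʳ _ ⟨
      count (¬? ∘ free? κ) ℕ.+ 0                      ≡⟨ cong (count (¬? ∘ free? κ) ℕ.+_) neighboursBelow-zero ⟨
      count (¬? ∘ free? κ) ℕ.+ neighboursBelow κ 0    ≡⟨ staircase-top m (neighboursBelow κ) (free? κ)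
                                                           neighboursBelow-free neighboursBelow-taken ⟨
      neighboursBelow κ m                             ≡⟨ count-cong
        (λ j → neighbour? H j ×-dec toℕ (Vec.lookup κ j) ℕ.<? m) (neighbour? H)
        (λ _ → proj₁) (λ j 0⊀j → 0⊀j , Fin.toℕ<n (Vec.lookup κ j)) ⟩
      degree H                                        ∎
      where open ≡-Reasoning

    insertion-sum : ∀ (g : ℕ → ℤ) s →
      ∑< (suc m) (λ c → g (neighboursBelow κ c ℕ.+ s)) ≡
      sum (λ c → g (neighboursBelow κ (toℕ c) ℕ.+ s) when free? κ c) + ([1+ degree H ]· g) s
    insertion-sum g s = trans
      (∑<-staircase m (neighboursBelow κ) (λ r → g (r ℕ.+ s)) (free? κ) neighboursBelow-free neighboursBelow-taken)
      (cong (sum (λ c → g (neighboursBelow κ (toℕ c) ℕ.+ s) when free? κ c) +_) (trans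
        (cong (λ d → ∑< (suc d) λ r → g (r ℕ.+ neighboursBelow κ 0 ℕ.+ s)) taken-count)
        (∑<-cong (suc (degree H)) λ r → cong (λ x → g (x ℕ.+ s))
          (trans (cong (r ℕ.+_) neighboursBelow-zero) (ℕ.+-identityʳ r)))))

lookup-punchIn-< : ∀ c (κ : Vec (Fin m) n) i j →
  does (Vec.lookup (Vec.map (punchIn c) κ) i Fin.<? Vec.lookup (Vec.map (punchIn c) κ) j) ≡
  does (Vec.lookup κ i Fin.<? Vec.lookup κ j)
lookup-punchIn-< c κ i j rewrite Vec.lookup-map i (punchIn c) κ | Vec.lookup-map j (punchIn c) κ =
  does-⇔ (punchIn c (Vec.lookup κ i) Fin.<? punchIn c (Vec.lookup κ j)) (Vec.lookup κ i Fin.<? Vec.lookup κ j)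
    (punchIn-cancel-< c) (punchIn-mono-< c)

colorInversions-punchIn : ∀ (H : Hessenberg n) c (κ : Vec (Fin m) n) →
  colorInversions H (Vec.lookup (Vec.map (punchIn c) κ)) ≡ colorInversions H (Vec.lookup κ)
colorInversions-punchIn H c κ = ∑ℕ.sum-cong-≗ λ i → ∑ℕ.sum-cong-≗ λ j →
  cong (λ b → if does (i Fin.<? j) ∧ (does (¬? (i ≺? j)) ∧ b) then 1 else 0) (lookup-punchIn-< c κ j i)
  where open Hessenberg H

properColoring-punchIn : ∀ (H : Hessenberg n) c (κ : Vec (Fin m) n) x →
  (x when properColoring? H (Vec.lookup (Vec.map (punchIn c) κ))) ≡ (x when properColoring? H (Vec.lookup κ))
properColoring-punchIn H c κ x =
  when-⇔ (properColoring? H (Vec.lookup (Vec.map (punchIn c) κ))) (properColoring? H (Vec.lookup κ)) x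
    (λ proper i j i<j i⊀j eq → proper i j i<j i⊀j
      (trans (Vec.lookup-map i (punchIn c) κ) (trans (cong (punchIn c) eq) (sym (Vec.lookup-map j (punchIn c) κ)))))
    (λ proper i j i<j i⊀j eq → proper i j i<j i⊀j (Fin.punchIn-injective c _ _
      (trans (sym (Vec.lookup-map i (punchIn c) κ)) (trans eq (Vec.lookup-map j (punchIn c) κ)))))

-- The hypothesis `insertion` of `∑±-suc`. On the left c is the place of a new block and `punchIn c`
-- makes room for it; on the right c is an existing block. For proper `κ` this is `insertion-sum`,
-- and otherwise every term is zero.
colorWeight-insertion : ∀ (H : Hessenberg (suc n)) g m (κ : Vec (Fin m) n) →
  sum (λ c → colorWeight H g (c ∷ Vec.map (punchIn c) κ)) ≡
  sum (λ c → colorWeight H g (c ∷ κ)) + colorWeight (restrict H) ([1+ degree H ]· g) κ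
colorWeight-insertion {n} H g m κ = begin
  sum (λ c → colorWeight H g (c ∷ Vec.map (punchIn c) κ))
    ≡⟨ sum-cong-≗ {suc m} new-block ⟩
  sum {suc m} (λ c → g (neighboursBelow H κ (toℕ c) ℕ.+ s) when isProper?)
    ≡⟨ sum-when {suc m} (λ c → g (neighboursBelow H κ (toℕ c) ℕ.+ s)) isProper? ⟩
  (∑< (suc m) (λ c → g (neighboursBelow H κ c ℕ.+ s)) when isProper?)
    ≡⟨ evaluate isProper? ⟩
  (sum (λ c → g (neighboursBelow H κ (toℕ c) ℕ.+ s) when free? H κ c) + ([1+ degree H ]· g) s when isProper?)
    ≡⟨ when-+ isProper? (sum λ c → g (neighboursBelow H κ (toℕ c) ℕ.+ s) when free? H κ c) (([1+ degree H ]· g) s) ⟩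
  (sum (λ c → g (neighboursBelow H κ (toℕ c) ℕ.+ s) when free? H κ c) when isProper?) +
  colorWeight (restrict H) ([1+ degree H ]· g) κ
    ≡⟨ cong (_+ colorWeight (restrict H) ([1+ degree H ]· g) κ) (trans
         (sum-cong-≗ {m} λ c → colorWeight-∷ H g c κ)
         (sum-when (λ c → g (neighboursBelow H κ (toℕ c) ℕ.+ s) when free? H κ c) isProper?)) ⟨
  sum (λ c → colorWeight H g (c ∷ κ)) + colorWeight (restrict H) ([1+ degree H ]· g) κ ∎
  where
  open ≡-Reasoning
  s = colorInversions (restrict H) (Vec.lookup κ)
  isProper? = properColoring? (restrict H) (Vec.lookup κ)

  evaluate : ∀ (d : Dec (ProperColoring (restrict H) (Vec.lookup κ))) →
    (∑< (suc m) (λ c → g (neighboursBelow H κ c ℕ.+ s)) when d) ≡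
    (sum (λ c → g (neighboursBelow H κ (toℕ c) ℕ.+ s) when free? H κ c) + ([1+ degree H ]· g) s when d)
  evaluate (yes proper) = insertion-sum H κ proper g s
  evaluate (no _)       = refl

  below-punchIn : ∀ (c : Fin (suc m)) → neighboursBelow H (Vec.map (punchIn c) κ) (toℕ c) ≡ neighboursBelow H κ (toℕ c)
  below-punchIn c = ∑ℕ.sum-cong-≗ {n} λ j → cong (λ b → if does (neighbour? H j) ∧ b then 1 else 0)
    (trans (cong (λ x → does (x Fin.<? c)) (Vec.lookup-map j (punchIn c) κ)) (punchIn-< c (Vec.lookup κ j)))
    where
    punchIn-< : ∀ {k} (c : Fin (suc k)) (x : Fin k) → does (punchIn c x Fin.<? c) ≡ does (toℕ x ℕ.<? toℕ c)
    punchIn-< zero    x       = refl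
    punchIn-< (suc c) zero    = refl
    punchIn-< (suc c) (suc x) = punchIn-< c x

  new-block : ∀ c → colorWeight H g (c ∷ Vec.map (punchIn c) κ) ≡ (g (neighboursBelow H κ (toℕ c) ℕ.+ s) when isProper?)
  new-block c = begin
    colorWeight H g (c ∷ Vec.map (punchIn c) κ)
      ≡⟨ colorWeight-∷ H g c (Vec.map (punchIn c) κ) ⟩
    ((g (neighboursBelow H κ⁺ (toℕ c) ℕ.+ colorInversions (restrict H) (Vec.lookup κ⁺)) when free? H κ⁺ c)
      when properColoring? (restrict H) (Vec.lookup κ⁺))
      ≡⟨ properColoring-punchIn (restrict H) c κ _ ⟩
    ((g (neighboursBelow H κ⁺ (toℕ c) ℕ.+ colorInversions (restrict H) (Vec.lookup κ⁺)) when free? H κ⁺ c) when isProper?)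
      ≡⟨ cong (_when isProper?) (when-true {d = free? H κ⁺ c} λ (j , _ , eq) →
           Fin.punchInᵢ≢i c _ (trans (sym (Vec.lookup-map j (punchIn c) κ)) eq)) ⟩
    (g (neighboursBelow H κ⁺ (toℕ c) ℕ.+ colorInversions (restrict H) (Vec.lookup κ⁺)) when isProper?)
      ≡⟨ cong₂ (λ a b → g (a ℕ.+ b) when isProper?) (below-punchIn c) (colorInversions-punchIn (restrict H) c κ) ⟩
    (g (neighboursBelow H κ (toℕ c) ℕ.+ s) when isProper?) ∎
    where κ⁺ = Vec.map (punchIn c) κ

-- L(X) sorted by the number m of colours used, where `sign (n ℕ.+ m)` stands for (-1)^(n - m).
alternatingColorSum : Hessenberg n → (ℕ → ℤ) → ℤ
alternatingColorSum {n} H g = ∑< (suc n) λ m → sign (n ℕ.+ m) * ∑ˢ m n (colorWeight H g)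

-- Both sides obey the same recursion, which replaces `g` by `[1+ degree H ]· g`; hence the
-- quantification over `g`.
alternatingColorSum≡nonExcedantSum : ∀ (H : Hessenberg n) g → alternatingColorSum H g ≡ nonExcedantSum H g
alternatingColorSum≡nonExcedantSum {zero}  H g = cong (_+ 0ℤ) (ℤ.*-identityˡ (g 0))
alternatingColorSum≡nonExcedantSum {suc n} H g = begin
  alternatingColorSum H g
    ≡⟨ ∑±-suc n (λ _ → colorWeight H g) (λ _ → colorWeight (restrict H) ([1+ degree H ]· g)) (colorWeight-insertion H g) ⟩
  alternatingColorSum (restrict H) ([1+ degree H ]· g)
    ≡⟨ alternatingColorSum≡nonExcedantSum (restrict H) ([1+ degree H ]· g) ⟩
  nonExcedantSum (restrict H) ([1+ degree H ]· g)
    ≡⟨ nonExcedantSum-suc H g ⟨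
  nonExcedantSum H g ∎
  where open ≡-Reasoning

-- The chromatic quasisymmetric function

vectors-∑ᵛ : ∀ n (F : Vec (Fin m) n → ℤ) → ∑ˡ (vectors (allFin m) n) F ≡ ∑ᵛ n F
vectors-∑ᵛ         zero    F = ℤ.+-identityʳ _
vectors-∑ᵛ {m = m} (suc n) F = trans
  (∑ˡ-cartesianProductWith _∷_ (allFin m) (vectors (allFin m) n) F)
  (trans (∑ˡ-tabulate id (λ c → ∑ˡ (vectors (allFin m) n) λ κ → F (c ∷ κ)))
         (sum-cong-≗ {m} λ c → vectors-∑ᵛ n (F ∘ (c ∷_))))

infix 4 _≟ᴸ_
_≟ᴸ_ : (α β : List ℕ) → Dec (α ≡ β)
_≟ᴸ_ = List.≡-dec ℕ._≟_

altSum₊-vanishing : ∀ g n → (∀ a α → g a α ≡ 0ℤ) → altSum₊ g n ≡ 0ℤ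
altSum₊-vanishing g n eq = trans (altSum₊-cong n λ a α _ _ → eq a α) (altSum₊-zero n)

altSum₊-single : ∀ b g n → (∀ a α → a ≢ b → g a α ≡ 0ℤ) →
                 altSum₊ g (suc (b ℕ.+ n)) ≡ sign b * altSum (g b) n
altSum₊-single zero    g n vanish = trans
  (cong (λ x → altSum (g 0) n - x) (altSum₊-vanishing (g ∘ suc) n λ a α → vanish (suc a) α λ ()))
  (trans (ℤ.+-identityʳ _) (sym (ℤ.*-identityˡ _)))
altSum₊-single (suc b) g n vanish = trans
  (cong₂ _-_ (trans (altSum-cong (suc (b ℕ.+ n)) λ α _ _ → vanish 0 α λ ()) (altSum-zero (suc (b ℕ.+ n))))
             (altSum₊-single b (g ∘ suc) n λ a α a≢b → vanish (suc a) α (a≢b ∘ ℕ.suc-injective)))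
  (trans (ℤ.+-identityˡ _) (ℤ.neg-distribˡ-* (sign b) _))

-- A part b + 1 contributes (-1)^b. Over all parts the exponent is the sum minus the length, which
-- has the parity of sum plus length.
altSum-monomial : ∀ β → All (0 ℕ.<_) β → ∀ x →
  altSum (λ α → x when β ≟ᴸ α) (ListAction.sum β) ≡ sign (ListAction.sum β ℕ.+ length β) * x
altSum-monomial []          []        x = sym (ℤ.*-identityˡ x)
altSum-monomial (suc b ∷ β) (_ ∷ pos) x = begin
  altSum₊ (λ a α → x when suc b ∷ β ≟ᴸ suc a ∷ α) (suc (b ℕ.+ ListAction.sum β))
    ≡⟨ altSum₊-single b (λ a α → x when suc b ∷ β ≟ᴸ suc a ∷ α) (ListAction.sum β) (λ a α a≢b →
         when-false {d = suc b ∷ β ≟ᴸ suc a ∷ α} λ { refl → a≢b refl }) ⟩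
  sign b * altSum (λ α → x when suc b ∷ β ≟ᴸ suc b ∷ α) (ListAction.sum β)
    ≡⟨ cong (sign b *_) (trans
         (altSum-cong (ListAction.sum β) λ α _ _ →
            when-⇔ (suc b ∷ β ≟ᴸ suc b ∷ α) (β ≟ᴸ α) x (λ { refl → refl }) (cong (suc b ∷_)))
         (altSum-monomial β pos x)) ⟩
  sign b * (sign (ListAction.sum β ℕ.+ length β) * x)
    ≡⟨ ℤ.*-assoc (sign b) _ x ⟨
  sign b * sign (ListAction.sum β ℕ.+ length β) * x
    ≡⟨ cong (_* x) (trans (sym (sign-+ b _)) (trans (sym (ℤ.neg-involutive _))
         (cong sign (trans (cong suc (cong suc (sym (ℕ.+-assoc b _ (length β)))))
                           (cong suc (sym (ℕ.+-suc _ (length β)))))))) ⟩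
  sign (suc (b ℕ.+ ListAction.sum β) ℕ.+ suc (length β)) * x ∎
  where open ≡-Reasoning

altSum-nonpositive : ∀ β → ¬ All (0 ℕ.<_) β → ∀ x n → altSum (λ α → x when β ≟ᴸ α) n ≡ 0ℤ
altSum-nonpositive β ¬pos x n = trans
  (altSum-cong n λ α pos _ → when-false {d = β ≟ᴸ α} λ { refl → ¬pos pos })
  (altSum-zero n)

altSum-∑ᵛ : ∀ n (F : Vec (Fin m) n → Series ℤ) k →
            altSum (λ α → ∑ᵛ n λ κ → F κ α) k ≡ ∑ᵛ n λ κ → altSum (F κ) k
altSum-∑ᵛ         zero    F k = refl
altSum-∑ᵛ {m = m} (suc n) F k = trans
  (altSum-sum (λ c α → ∑ᵛ n λ κ → F (c ∷ κ) α) k)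
  (sum-cong-≗ {m} λ c → altSum-∑ᵛ n (F ∘ (c ∷_)) k)

-- The exponent vector of the monomial x_κ.
content : Vec (Fin m) n → List ℕ
content κ = List.tabulate λ c → count λ i → Vec.lookup κ i Fin.≟ c

sum-tabulate : ∀ (f : Fin m → ℕ) → ListAction.sum (List.tabulate f) ≡ ∑ℕ.sum f
sum-tabulate {zero}  f = refl
sum-tabulate {suc m} f = cong (f zero ℕ.+_) (sum-tabulate (f ∘ suc))

sum-content : ∀ (κ : Vec (Fin m) n) → ListAction.sum (content κ) ≡ n
sum-content {m} {n} κ = begin
  ListAction.sum (content κ)
    ≡⟨ sum-tabulate (λ c → count λ i → Vec.lookup κ i Fin.≟ c) ⟩
  ∑ℕ.sum (λ c → count λ i → Vec.lookup κ i Fin.≟ c)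
    ≡⟨ ∑ℕ.∑-comm {m} {n} (λ c i → ⟦ Vec.lookup κ i Fin.≟ c ⟧) ⟩
  ∑ℕ.sum (λ i → count λ c → Vec.lookup κ i Fin.≟ c)
    ≡⟨ ∑ℕ.sum-cong-≗ {n} (λ i → trans
         (count-cong (Vec.lookup κ i Fin.≟_) (Fin._≟ Vec.lookup κ i) (λ _ → sym) (λ _ → sym))
         (count-≟ (Vec.lookup κ i))) ⟩
  ∑ℕ.sum {n} (λ _ → 1)
    ≡⟨ ones n ⟩
  n ∎
  where
  open ≡-Reasoning
  ones : ∀ n → ∑ℕ.sum {n} (λ _ → 1) ≡ n
  ones zero    = refl
  ones (suc n) = cong suc (ones n)

count-positive : ∀ {P : Pred (Fin n) 0ℓ} (P? : Decidable P) → ∃ P → 0 ℕ.< count P?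
count-positive P? (zero  , p) = ℕ.<-≤-trans (ℕ.≤-reflexive (sym (⟦⟧-true {d = P? zero} p))) (ℕ.m≤m+n _ _)
count-positive P? (suc i , p) = ℕ.<-≤-trans (count-positive (P? ∘ suc) (i , p)) (ℕ.m≤n+m _ ⟦ P? zero ⟧)

positive-count : ∀ {P : Pred (Fin n) 0ℓ} (P? : Decidable P) → 0 ℕ.< count P? → ∃ P
positive-count {suc n} P? pos with P? zero
... | yes p = zero , p
... | no _  = let (i , p) = positive-count (P? ∘ suc) pos in suc i , p

-- The exponents of x_κ form a composition precisely when every colour is used; that composition has
-- sum n and length m.
altSum-content : ∀ (κ : Vec (Fin m) n) x →
  altSum (λ α → x when content κ ≟ᴸ α) n ≡ (sign (n ℕ.+ m) * x when surjective? κ)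
altSum-content {m} {n} κ x with All.all? (0 ℕ.<?_) (content κ)
... | yes pos = begin
  altSum (λ α → x when content κ ≟ᴸ α) n
    ≡⟨ cong (altSum λ α → x when content κ ≟ᴸ α) (sum-content κ) ⟨
  altSum (λ α → x when content κ ≟ᴸ α) (ListAction.sum (content κ))
    ≡⟨ altSum-monomial (content κ) pos x ⟩
  sign (ListAction.sum (content κ) ℕ.+ length (content κ)) * x
    ≡⟨ cong₂ (λ a b → sign (a ℕ.+ b) * x) (sum-content κ) (List.length-tabulate _) ⟩
  sign (n ℕ.+ m) * x
    ≡⟨ when-true {d = surjective? κ} (λ c →
         positive-count (λ i → Vec.lookup κ i Fin.≟ c) (All.tabulate⁻ pos c)) ⟨
  (sign (n ℕ.+ m) * x when surjective? κ) ∎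
  where open ≡-Reasoning
... | no ¬pos = trans (altSum-nonpositive (content κ) ¬pos x n)
  (sym (when-false {d = surjective? κ} λ surj →
    ¬pos (All.tabulate⁺ λ c → count-positive (λ i → Vec.lookup κ i Fin.≟ c) (surj c))))

∑<-single : ∀ N k (h : ℕ → ℤ) → k ℕ.< N → (∀ i → i ≢ k → h i ≡ 0ℤ) → ∑< N h ≡ h k
∑<-single (suc N) zero    h _         vanish =
  trans (cong (h 0 +_) (sum-zero {N} λ i → vanish (suc (toℕ i)) λ ())) (ℤ.+-identityʳ _)
∑<-single (suc N) (suc k) h (s≤s k<N) vanish = trans
  (cong₂ _+_ (vanish 0 λ ()) (∑<-single N k (h ∘ suc) k<N λ i i≢k → vanish (suc i) (i≢k ∘ ℕ.suc-injective)))
  (ℤ.+-identityˡ _)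

tabulate-injective : ∀ {f g : Fin n → ℕ} → List.tabulate f ≡ List.tabulate g → f ≗ g
tabulate-injective eq zero    = proj₁ (List.∷-injective eq)
tabulate-injective eq (suc i) = tabulate-injective (proj₂ (List.∷-injective eq)) i

module _ (P : UnitIntervalOrder n) (labeled : WellLabeled P) where
  open UnitIntervalOrder P
  private
    H : Hessenberg n
    H = hessenberg P labeled
  open Hessenberg H using (≺⇒<)

  incomparable⇒⊀ : ∀ {i j} → Incomparable i j → ¬ i ≺ j
  incomparable⇒⊀ (i⋠j , _) (i≼j , _) = i⋠j i≼j

  ⊀⇒incomparable : ∀ {i j} → i Fin.< j → ¬ i ≺ j → Incomparable i j
  ⊀⇒incomparable i<j i⊀j =
    (λ i≼j → i⊀j (i≼j , λ { refl → ℕ.<-irrefl refl i<j })) ,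
    (λ j≼i → ℕ.<-asym i<j (≺⇒< (j≼i , λ { refl → ℕ.<-irrefl refl i<j })))

  colorInv≡colorInversions : ∀ (κ : Fin n → Fin m) → colorInv P κ ≡ colorInversions H κ
  colorInv≡colorInversions κ = trans
    (#pairs≡∑count {n} (λ (i , j) → i Fin.<? j ×-dec incomparable? i j ×-dec κ j Fin.<? κ i))
    (∑ℕ.sum-cong-≗ λ i → count-cong
      (λ j → i Fin.<? j ×-dec incomparable? i j ×-dec κ j Fin.<? κ i)
      (λ j → i Fin.<? j ×-dec ¬? (i ≺? j) ×-dec κ j Fin.<? κ i)
      (λ j (i<j , inc , lt) → i<j , incomparable⇒⊀ inc , lt)
      (λ j (i<j , i⊀j , lt) → i<j , ⊀⇒incomparable i<j i⊀j , lt))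

  proper⇒properColoring : ∀ (κ : Fin n → Fin m) → Proper P κ → ProperColoring H κ
  proper⇒properColoring κ proper i j i<j i⊀j = proper i j (⊀⇒incomparable i<j i⊀j)

  properColoring⇒proper : ∀ (κ : Fin n → Fin m) → ProperColoring H κ → Proper P κ
  properColoring⇒proper κ proper i j inc@(i⋠j , j⋠i) with Fin.<-cmp i j
  ... | tri< i<j _ _ = proper i j i<j (incomparable⇒⊀ inc)
  ... | tri≈ _ refl _ = contradiction (Poset.refl poset) i⋠j
  ... | tri> _ _ j<i = proper j i j<i (incomparable⇒⊀ (j⋠i , i⋠j)) ∘ sym

  hasMonomial⇒content : ∀ α (κ : Vec (Fin (length α)) n) → HasMonomial P α (Vec.lookup κ) → content κ ≡ α
  hasMonomial⇒content α κ mono = trans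
    (List.tabulate-cong λ c → trans (sym (#≡count λ i → Vec.lookup κ i Fin.≟ c)) (mono c))
    (List.tabulate-lookup α)

  content⇒hasMonomial : ∀ α (κ : Vec (Fin (length α)) n) → content κ ≡ α → HasMonomial P α (Vec.lookup κ)
  content⇒hasMonomial α κ eq c = trans (#≡count λ i → Vec.lookup κ i Fin.≟ c)
    (tabulate-injective (trans eq (sym (List.tabulate-lookup α))) c)

  coeff-chromatic : ∀ k α → coeff (chromatic P α) k ≡
    ∑ᵛ n (λ (κ : Vec (Fin (length α)) n) → colorWeight H (λ s → coeff (q^ s) k) κ when content κ ≟ᴸ α)
  coeff-chromatic k α = begin
    coeff (chromatic P α) k
      ≡⟨ coeff-Σₚ (filter admissible? colorings) (λ κ → q^ colorInv P (Vec.lookup κ)) k ⟩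
    ∑ˡ (filter admissible? colorings) weight
      ≡⟨ ∑ˡ-filter admissible? colorings weight ⟩
    ∑ˡ colorings (λ κ → weight κ when admissible? κ)
      ≡⟨ vectors-∑ᵛ n (λ κ → weight κ when admissible? κ) ⟩
    ∑ᵛ n (λ κ → weight κ when admissible? κ)
      ≡⟨ ∑ᵛ-cong n (λ κ → trans
           (when-⇔ (admissible? κ) ((content κ ≟ᴸ α) ×-dec properColoring? H (Vec.lookup κ)) (weight κ)
             (λ (proper , mono) → hasMonomial⇒content α κ mono , proper⇒properColoring (Vec.lookup κ) proper)
             (λ (eq , proper) → properColoring⇒proper (Vec.lookup κ) proper , content⇒hasMonomial α κ eq))
           (trans (when-× (content κ ≟ᴸ α) (properColoring? H (Vec.lookup κ)) (weight κ))
             (cong (λ s → (coeff (q^ s) k when properColoring? H (Vec.lookup κ)) when content κ ≟ᴸ α)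
                   (colorInv≡colorInversions (Vec.lookup κ))))) ⟩
    ∑ᵛ n (λ κ → colorWeight H (λ s → coeff (q^ s) k) κ when content κ ≟ᴸ α) ∎
    where
    open ≡-Reasoning
    colorings = vectors (allFin (length α)) n
    admissible? : (κ : Vec (Fin (length α)) n) → Dec (Proper P (Vec.lookup κ) × HasMonomial P α (Vec.lookup κ))
    admissible? κ = proper? P (Vec.lookup κ) ×-dec hasMonomial? P α (Vec.lookup κ)
    weight : Vec (Fin (length α)) n → ℤ
    weight κ = coeff (q^ colorInv P (Vec.lookup κ)) k

  altSum-chromatic≡alternatingColorSum : ∀ k →
    altSum (λ α → coeff (chromatic P α) k) n ≡ alternatingColorSum H (λ s → coeff (q^ s) k)
  altSum-chromatic≡alternatingColorSum k = begin
    altSum (λ α → coeff (chromatic P α) k) n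
      -- The number of colours is tied to `α`. Summing over all m ≤ n, where only m = `length α`
      -- contributes, removes this dependence, so that L can be exchanged with the sum over
      -- colourings.
      ≡⟨ altSum-cong n (λ α _ α≤n → trans (coeff-chromatic k α)
           (sym (∑<-single (suc n) (length α) (λ m → colorSum m α) (s≤s α≤n) (wrong-length α)))) ⟩
    altSum (λ α → ∑< (suc n) (λ m → colorSum m α)) n
      ≡⟨ altSum-sum {suc n} (λ m → colorSum (toℕ m)) n ⟩
    ∑< (suc n) (λ m → altSum (colorSum m) n)
      ≡⟨ ∑<-cong (suc n) (λ m → trans
           (altSum-∑ᵛ {m} n (λ κ α → colorWeight H (λ s → coeff (q^ s) k) κ when content κ ≟ᴸ α) n)
           (trans (∑ᵛ-cong {m} n λ κ → altSum-content κ (colorWeight H (λ s → coeff (q^ s) k) κ))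
                  (factor m (sign (n ℕ.+ m)) (colorWeight H (λ s → coeff (q^ s) k))))) ⟩
    alternatingColorSum H (λ s → coeff (q^ s) k) ∎
    where
    open ≡-Reasoning
    colorSum : ℕ → Series ℤ
    colorSum m α = ∑ᵛ {m} n λ κ → colorWeight H (λ s → coeff (q^ s) k) κ when content κ ≟ᴸ α

    wrong-length : ∀ α m → m ≢ length α → colorSum m α ≡ 0ℤ
    wrong-length α m m≢ = ∑ᵛ-zero {m} n λ κ → when-false {d = content κ ≟ᴸ α} λ eq →
      m≢ (trans (sym (List.length-tabulate _)) (cong length eq))

    ∑ᵛ-* : ∀ {m} n x (F : Vec (Fin m) n → ℤ) → ∑ᵛ n (λ κ → x * F κ) ≡ x * ∑ᵛ n F
    ∑ᵛ-*         zero    x F = refl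
    ∑ᵛ-* {m} (suc n) x F = trans (sum-cong-≗ {m} λ c → ∑ᵛ-* n x (F ∘ (c ∷_)))
                                 (sym (*-distribˡ-sum x (λ c → ∑ᵛ n (F ∘ (c ∷_)))))

    when-* : ∀ x y (d : Dec A) → (x * y when d) ≡ x * (y when d)
    when-* x y d with does d
    ... | true  = refl
    ... | false = sym (ℤ.*-zeroʳ x)

    factor : ∀ m x (F : Vec (Fin m) n → ℤ) → ∑ᵛ n (λ κ → x * F κ when surjective? κ) ≡ x * ∑ˢ m n F
    factor m x F = trans (∑ᵛ-cong n λ κ → when-* x (F κ) (surjective? κ)) (∑ᵛ-* n x λ κ → F κ when surjective? κ)

  ∑φ≡nonExcedantSum : ∀ φ → IsElementaryExpansion P φ → ∀ k →
    coeff (Σₚ (partitions n) φ) k ≡ nonExcedantSum H (λ s → coeff (q^ s) k)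
  ∑φ≡nonExcedantSum φ X≈ k = begin
    coeff (Σₚ (partitions n) φ) k                 ≡⟨ altSum-chromatic P φ X≈ k ⟨
    altSum (λ α → coeff (chromatic P α) k) n      ≡⟨ altSum-chromatic≡alternatingColorSum k ⟩
    alternatingColorSum H (λ s → coeff (q^ s) k)  ≡⟨ alternatingColorSum≡nonExcedantSum H (λ s → coeff (q^ s) k) ⟩
    nonExcedantSum H (λ s → coeff (q^ s) k)       ∎
    where open ≡-Reasoning

  ∑inv≡nonExcedantSum : ∀ k →
    coeff (Σₚ (filter (excedanceFree? P) (permutations n)) (λ U → q^ inv U)) k ≡
    nonExcedantSum H (λ s → coeff (q^ s) k)
  ∑inv≡nonExcedantSum k = trans
    (coeff-Σₚ (filter (excedanceFree? P) (permutations n)) (λ U → q^ inv U) k)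
    (trans (∑ˡ-filter (excedanceFree? P) (permutations n) (λ U → coeff (q^ inv U) k))
      (∑ˡ-cong (permutations n) λ U →
        cong (λ s → coeff (q^ s) k when excedanceFree? P U) (inv≡inversions U)))

  ∑ℓ≡∑inv : ∀ w → IsWord P w → ∀ k →
    coeff (Σₚ (filter (λ v → v ≤ᴮ? w) (permutations n)) (λ v → q^ ℓ v)) k ≡
    coeff (Σₚ (filter (excedanceFree? P) (permutations n)) (λ U → q^ inv U)) k
  ∑ℓ≡∑inv w isWord k = begin
    coeff (Σₚ (filter (_≤ᴮ? w) (permutations n)) (λ v → q^ ℓ v)) k
      ≡⟨ cong (λ vs → coeff (Σₚ vs (λ v → q^ ℓ v)) k) (List.filter-≐ (_≤ᴮ? w) (excedanceFree? P)
           ((λ v≤w → ≤ᴮ⇒nonExcedant H v≤w free-w) , (λ {v} → nonExcedant⇒≤ᴮ H w free-w w-max v))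
           (permutations n)) ⟩
    coeff (Σₚ free (λ v → q^ ℓ v)) k
      ≡⟨ coeff-Σₚ free (λ v → q^ ℓ v) k ⟩
    ∑ˡ free (λ v → coeff (q^ ℓ v) k)
      ≡⟨ ∑ˡ-cong free (λ v → cong (λ s → coeff (q^ s) k) (ℓ≡inv v)) ⟩
    ∑ˡ free (λ v → coeff (q^ inv v) k)
      ≡⟨ coeff-Σₚ free (λ v → q^ inv v) k ⟨
    coeff (Σₚ free (λ U → q^ inv U)) k ∎
    where
    open ≡-Reasoning
    free = filter (excedanceFree? P) (permutations n)
    free-w : Hessenberg.NonExcedant H w
    free-w (j , j≺) = proj₁ (proj₁ (isWord j)) j≺
    w-max : ∀ j i → ¬ j ≺ i → (∀ k → k Fin.< j → i ≢ w ⟨$⟩ʳ k) → i Fin.≤ w ⟨$⟩ʳ j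
    w-max j i j⊀i new = proj₂ (isWord j) i (j⊀i , new)

proposition5p2 : ∀ (n : ℕ) (P : UnitIntervalOrder n) → WellLabeled P →
    ∀ (w : Permutation′ n) → IsWord P w →
    ∀ (φ : List ℕ → ℤ[q]) → IsElementaryExpansion P φ →
    (Σₚ (partitions n) φ ≈ₚ Σₚ (filter (λ v → v ≤ᴮ? w) (permutations n)) (λ v → q^ ℓ v))
    × (Σₚ (filter (λ v → v ≤ᴮ? w) (permutations n)) (λ v → q^ ℓ v)
    ≈ₚ Σₚ (filter (excedanceFree? P) (permutations n)) (λ U → q^ inv U))
proposition5p2 n P labeled w isWord φ X≈ =
  (λ k → trans (∑φ≡nonExcedantSum P labeled φ X≈ k)
           (sym (trans (∑ℓ≡∑inv P labeled w isWord k) (∑inv≡nonExcedantSum P labeled k)))) ,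
  ∑ℓ≡∑inv P labeled w isWord
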